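{- Let $\mathcal{S}=\{\emptyset,\{4,5,6\},\{1,3,4\},\{1,2,5,6\},\{1,2,3,4\}\}\subset\mathcal{P}([6])$. Then $\mathcal{S}$ is a counterexample to the following conjecture: "If $n\ge3$ and $\mathcal{S}$ is a family of sets with $U(\mathcal{S})=[n]$ that is a minimal generator for a union-closed family $\mathcal{F}$ which is a Non-FC-family, then $\mathcal{S}$ is regular." That is: $U(\mathcal{S})=[6]$, $\mathcal{S}$ is a minimal generator of $\langle\mathcal{S}\rangle$, $\langle\mathcal{S}\rangle$ is a Non-FC-family, and $\mathcal{S}$ is not regular.
   Context: A UC (union-closed) family is a nonempty finite family $\mathcal{F}$ of distinct finite sets such that $A\cup B\in\mathcal{F}$ for all $A,B\in\mathcal{F}$. $[n]=\{1,\dots,n\}$, $\mathcal{P}([n])$ is its power set, $U(\mathcal{F})$ is the union of all sets in $\mathcal{F}$, and $\mathcal{F}_i=\{F\in\mathcal{F} : i\in F\}$. A UC family $\mathcal{A}$, whose largest set is $U(\mathcal{A})$, is an FC-family iff for every UC family $\mathcal{F}\supseteq\mathcal{A}$ there is $i\in U(\mathcal{A})$ with $|\mathcal{F}_i|\ge|\mathcal{F}|/2$; it is a Non-FC-family iff there is a UC family $\mathcal{F}\supseteq\mathcal{A}$ such that $|\mathcal{F}_i|<|\mathcal{F}|/2$ for every $i\in U(\mathcal{A})$. For a family of sets $\mathcal{S}$, $\langle\mathcal{S}\rangle$ is the UC family generated by $\mathcal{S}$, i.e. the smallest (under inclusion) UC family containing $\mathcal{S}$; $\mathcal{S}$ is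 a generator of $\mathcal{F}$ if $\langle\mathcal{S}\rangle=\mathcal{F}$, and it is a minimal generator if it does not properly contain another generator of $\mathcal{F}$. Regular: let $\mathcal{S}$ be a family with $U(\mathcal{S})=[n]$ that is a minimal generator for a UC family $\mathcal{F}$ which is a Non-FC-family. Then $\mathcal{S}$ is regular iff for every $A\in\mathcal{S}$ with $A\ne\emptyset$ and every $i\in[n]$, the UC family $\langle(\mathcal{S}\setminus\{A\})\cup\{A\cup\{i\}\}\rangle$ is Non-FC. -}

module Defs where

open import Data.List.Base using (List; []; _∷_; _++_; concat; filter; length; applyUpTo)
import Data.List.Membership.DecPropositional as ℕ-Membership
open import Data.List.Relation.Binary.BagAndSetEquality using ([_]-Equality; set)
import Data.List.Membership.Setoid as Membership
import Data.List.Relation.Binary.Subset.DecPropositional as DecSubset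
import Data.List.Relation.Binary.Subset.Setoid as Subset
import Data.List.Relation.Unary.Unique.Setoid as Unique
open import Data.Nat.Base using (ℕ; suc; _*_; _<_)
open import Data.Nat.Properties using (_≟_)
open import Data.Product.Base using (_×_; _,_; proj₁; proj₂; ∃-syntax)
open import Function.Bundles using (module Equivalence; mk⇔)
open import Level using (0ℓ)
open import Relation.Binary.Bundles using (Setoid)
open import Relation.Binary.Definitions using (Decidable)
open import Relation.Nullary.Decidable using (map′; _×-dec_; ¬?)
open import Relation.Nullary.Negation.Core using (¬_)

-- A finite set is a list of naturals up to equality of its elements, so that
-- the order and multiplicity of entries are irrelevant.  Taking the elements
-- to be naturals loses nothing, since a finite family of finite sets involves
-- only finitely many elements.

FinSet : Set
FinSet = List ℕ

open ℕ-Membership _≟_ public using (_∈_; _∈?_)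

finSetSetoid : Setoid 0ℓ 0ℓ
finSetSetoid = [ set ]-Equality ℕ

open Setoid finSetSetoid public using () renaming (_≈_ to _≋_)

infix 4 _≋?_

_≋?_ : Decidable _≋_
A ≋? B = map′ to from ((A ⊆? B) ×-dec (B ⊆? A))
  where
  open DecSubset _≟_ using (_⊆_; _⊆?_)

  to : A ⊆ B × B ⊆ A → A ≋ B
  to p = mk⇔ (λ x∈A → proj₁ p x∈A) (λ x∈B → proj₂ p x∈B)

  from : A ≋ B → A ⊆ B × B ⊆ A
  from A≋B = (λ x∈A → Equivalence.to A≋B x∈A) , (λ x∈B → Equivalence.from A≋B x∈B)

∅ : FinSet
∅ = []

infixr 6 _∪_

_∪_ : FinSet → FinSet → FinSet
_∪_ = _++_

⁅_⁆ : ℕ → FinSet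
⁅ i ⁆ = i ∷ []

[1⋯_] : ℕ → FinSet
[1⋯ n ] = applyUpTo suc n

-- Membership in, and inclusion of, families is up to _≋_.  Repetitions in a
-- family are excluded only where its cardinality matters, i.e. in UC.

Family : Set
Family = List FinSet

open Membership finSetSetoid public
  using () renaming (_∈_ to _∈ᶠ_)
open Subset finSetSetoid public
  using () renaming (_⊆_ to _⊆ᶠ_)
open Unique finSetSetoid public
  using () renaming (Unique to Distinct)

U : Family → FinSet
U = concat

infix 4 _⊂ᶠ_

_⊂ᶠ_ : Family → Family → Set
T ⊂ᶠ S = T ⊆ᶠ S × ¬ (S ⊆ᶠ T)

infixl 6 _∖_

_∖_ : Family → FinSet → Family
S ∖ A = filter (λ B → ¬? (B ≋? A)) S

infixl 7 _at_

_at_ : Family → ℕ → Family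
F at i = filter (i ∈?_) F

record UC (F : Family) : Set where
  field
    nonempty : ∃[ A ] A ∈ᶠ F
    distinct : Distinct F
    ∪-closed : ∀ A B → A ∈ᶠ F → B ∈ᶠ F → (A ∪ B) ∈ᶠ F

-- |F_i| < |F| / 2 is written without division.

NonFC : Family → Set
NonFC A = UC A ×
  (∃[ F ] UC F × A ⊆ᶠ F × (∀ i → i ∈ U A → 2 * length (F at i) < length F))

-- S GeneratorOf F says F = ⟨ S ⟩, the smallest UC family containing S.

infix 4 _GeneratorOf_ _MinimalGeneratorOf_

record _GeneratorOf_ (S F : Family) : Set where
  field
    uc       : UC F
    contains : S ⊆ᶠ F
    least    : ∀ G → UC G → S ⊆ᶠ G → F ⊆ᶠ G

_MinimalGeneratorOf_ : Family → Family → Set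
S MinimalGeneratorOf F =
  S GeneratorOf F × (∀ T → T ⊂ᶠ S → ¬ (T GeneratorOf F))

-- Only meaningful for S with U S ≋ [1⋯ n ] that is a minimal generator of a
-- Non-FC-family.  F ranges over the families representing
-- ⟨ (S ∖ A) ∪ { A ∪ { i } } ⟩, which all have the same members.

Regular : ℕ → Family → Set
Regular n S =
  ∀ A → A ∈ᶠ S → ¬ (A ≋ ∅) → ∀ i → i ∈ [1⋯ n ] →
  ∀ F → ((A ∪ ⁅ i ⁆) ∷ S ∖ A) GeneratorOf F → NonFC F

{-# OPTIONS --safe #-}

-- ⟨ S ⟩ is Non-FC: let Bᵢ consist of the subsets of [6] avoiding i, closed under
-- union with ⟨ S ⟩.  In a suitable multiset of B₁, …, B₆ every element of [6] has
-- frequency below one half by a margin that outweighs ⟨ S ⟩.  Placing the copies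
-- over distinct sets of new elements, and a full power set above them to absorb
-- the unions of members of different Bᵢ, which changes no margin, gives a UC
-- family containing ⟨ S ⟩.
--
-- S is not regular: replacing {1,2,3,4} by {1,2,3,4,5} generates an FC-family.
-- Following Poonen, there are weights c on [6] such that every union-closed family
-- of subsets of [6] closed under union with these generators has nonnegative sum of
-- c(Y) - c([6] ∖ Y).  Summing this over the classes of sets of F with equal trace
-- outside [6] contradicts all six elements being rare in F.  The inequality for c
-- is certified by a search tree whose leaves are flows.

module Submission where

open import Defs
open import Data.Bool.Base using (Bool; true; false; T; if_then_else_; _∨_)
import Data.Bool.Properties as Bool
open import Data.Empty using (⊥-elim)
open import Data.Fin.Subset using (Subset; ⊥; ⊤) renaming (_∪_ to _⊔_)
open import Data.Fin.Subset.Properties using ()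
  renaming ( ∪-assoc to ⊔-assoc; ∪-comm to ⊔-comm; ∪-idem to ⊔-idem
           ; ∪-identityˡ to ⊔-identityˡ; ∪-zeroˡ to ⊔-zeroˡ)
open import Data.Integer.Base as ℤ using (ℤ; +_; 0ℤ; 1ℤ; -1ℤ)
import Data.Integer.Properties as ℤ
open import Data.Integer.Solver using (module +-*-Solver)
open import Data.List.Base
  using (List; []; _∷_; _++_; cartesianProductWith; filter; foldl; foldr; length; map)
open import Data.List.Membership.Propositional using (find; lose) renaming (_∈_ to _∈ˡ_)
open import Data.List.Membership.Propositional.Properties
  using ( ∈-applyUpTo⁺; ∈-applyUpTo⁻; ∈-cartesianProductWith⁺; ∈-cartesianProductWith⁻
        ; ∈-filter⁺; ∈-filter⁻; ∈-map⁺; ∈-map⁻; ∈-++⁺ˡ; ∈-++⁺ʳ; ∈-++⁻)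
import Data.List.Membership.Setoid.Properties as Membership
open import Data.List.Properties using (filter-reject; length-filter)
open import Data.List.Relation.Unary.All as All using (All; []; _∷_; all?)
import Data.List.Relation.Unary.All.Properties as All
open import Data.List.Relation.Unary.AllPairs as AllPairs using (AllPairs; []; _∷_; allPairs?)
import Data.List.Relation.Unary.AllPairs.Properties as AllPairs
open import Data.List.Relation.Unary.Any as Any using (Any; here; there; any?)
open import Data.List.Relation.Unary.Unique.Propositional using () renaming (Unique to Uniqueˡ)
import Data.List.Relation.Unary.Unique.Propositional.Properties as Unique
open import Data.Nat.Base as ℕ
  using (ℕ; zero; suc; z≤n; s≤s; _≤_; _<_; _+_; _*_; _∸_; _^_; _≡ᵇ_; _≤ᵇ_)
open import Data.Nat.Induction using (Acc; acc; <-wellFounded)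
import Data.Nat.Properties as ℕ
open import Data.List.Relation.Binary.Subset.DecPropositional ℕ._≟_ using (_⊆?_)
open import Data.Product.Base using (_×_; _,_; proj₁; proj₂; ∃-syntax)
open import Data.Sum.Base using (_⊎_; inj₁; inj₂; [_,_]′)
open import Data.Unit.Base using (tt)
open import Data.Vec.Base as Vec using (Vec; []; _∷_)
import Data.Vec.Properties as Vec
open import Function.Base using (_∘_)
open import Function.Bundles using (mk⇔; module Equivalence)
open import Level using (0ℓ)
open import Relation.Binary.Bundles using (Setoid)
open import Relation.Binary.Core using (Rel)
open import Relation.Binary.Definitions
  using (Decidable; DecidableEquality; Reflexive; Symmetric; Transitive)
open import Relation.Binary.PropositionalEquality
  using (_≡_; _≢_; refl; sym; trans; cong; cong₂; subst; module ≡-Reasoning)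
open import Relation.Nullary.Decidable
  using ( Dec; yes; no; does; isYes; isYes≗does; map′; ¬?; _×-dec_; _⊎-dec_; does-⇔; dec-true
        ; dec-false; True; fromWitness; toWitness; toWitnessFalse)
open import Relation.Nullary.Negation.Core using (¬_; contradiction)
open import Relation.Unary using (Pred) renaming (Decidable to Decidable₁)

-- The two halves are the two alternatives of one linear duality. To each family B on [6] that is
-- closed under unions and absorbs the given sets, attach the vector of numbers of members with i
-- minus members without i. Either some nonzero nonnegative weights pair nonnegatively with all
-- these vectors, or a nonnegative combination of the vectors is negative in every coordinate. `⟨S⟩`
-- is on the second side, `⟨S′⟩` on the first. On the second side the combination must become one
-- family of distinct sets containing `⟨S⟩` unchanged. It has thousands of members, so closure and
-- margins are proved for the construction, and only sums over subsets of [6] are computed. On the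
-- first side there are too many families B to enumerate. A leaf of the search tree keeps only the
-- constraints "u in B implies t ∪ u in B" for sets t already known to be absorbed. Minimising a
-- linear function under these is a closure problem, dual to a network flow, so a flow certifies a
-- lower bound. Each branch fixes whether one set lies in B, until the bound reaches zero.

private module ≋ = Setoid finSetSetoid

-- Traces of finite sets as bit strings.

_≟ˢ_ : ∀ {n} → DecidableEquality (Subset n)
_≟ˢ_ = Vec.≡-dec Bool._≟_

-- Bit strings list the largest element first, so that a larger ground set is
-- obtained by prepending bits.

trace : ∀ n → FinSet → Subset n
trace zero    A = []
trace (suc n) A = does (suc n ∈? A) ∷ trace n A

trace-∪ : ∀ n A B → trace n (A ∪ B) ≡ trace n A ⊔ trace n B
trace-∪ zero    A B = refl
trace-∪ (suc n) A B = cong₂ _∷_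
  (does-⇔ (mk⇔ (∈-++⁻ A) [ ∈-++⁺ˡ , ∈-++⁺ʳ A ]′)
    (suc n ∈? A ++ B) ((suc n ∈? A) ⊎-dec (suc n ∈? B)))
  (trace-∪ n A B)

trace-cong : ∀ n {A B} → A ≋ B → trace n A ≡ trace n B
trace-cong zero            A≋B = refl
trace-cong (suc n) {A} {B} A≋B =
  cong₂ _∷_ (does-⇔ A≋B (suc n ∈? A) (suc n ∈? B)) (trace-cong n A≋B)

does-∈ : ∀ {x A B} → does (x ∈? A) ≡ does (x ∈? B) → x ∈ A → x ∈ B
does-∈ {x} {A} {B} eq x∈A with x ∈? B
... | yes x∈B = x∈B
... | no  _   = contradiction (trans (sym (dec-true (x ∈? A) x∈A)) eq) λ ()

trace-reflects : ∀ n {A B x} → trace n A ≡ trace n B → x ∈ [1⋯ n ] → x ∈ A → x ∈ B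
trace-reflects n {A} {B} eq x∈ x∈A with ∈-applyUpTo⁻ suc x∈
... | i , i<n , refl = go n i<n eq
  where
  go : ∀ n → i < n → trace n A ≡ trace n B → suc i ∈ B
  go (suc n) (s≤s i≤n) eq with ℕ.m≤n⇒m<n∨m≡n i≤n
  ... | inj₁ i<n  = go n i<n (cong Vec.tail eq)
  ... | inj₂ refl = does-∈ {A = A} (cong Vec.head eq) x∈A

-- Integer sums over lists and over equivalence classes.

sumOver : ∀ {A : Set} → (A → ℤ) → List A → ℤ
sumOver f = foldr (λ a → ℤ._+_ (f a)) 0ℤ

sumOver-cong : ∀ {A : Set} {f g : A → ℤ} → (∀ a → f a ≡ g a) → ∀ L → sumOver f L ≡ sumOver g L
sumOver-cong f≗g []      = refl
sumOver-cong f≗g (a ∷ L) = cong₂ ℤ._+_ (f≗g a) (sumOver-cong f≗g L)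

sumOver-0 : ∀ {A : Set} (L : List A) → sumOver (λ _ → 0ℤ) L ≡ 0ℤ
sumOver-0 []      = refl
sumOver-0 (_ ∷ L) = trans (ℤ.+-identityˡ _) (sumOver-0 L)

sumOver-++ : ∀ {A : Set} (f : A → ℤ) K L → sumOver f (K ++ L) ≡ sumOver f K ℤ.+ sumOver f L
sumOver-++ f []      L = sym (ℤ.+-identityˡ (sumOver f L))
sumOver-++ f (a ∷ K) L =
  trans (cong (ℤ._+_ (f a)) (sumOver-++ f K L)) (sym (ℤ.+-assoc (f a) (sumOver f K) (sumOver f L)))

sumOver-map : ∀ {A B : Set} (f : B → ℤ) (g : A → B) L → sumOver f (map g L) ≡ sumOver (f ∘ g) L
sumOver-map f g []      = refl
sumOver-map f g (a ∷ L) = cong (ℤ._+_ (f (g a))) (sumOver-map f g L)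

sumOver-+ : ∀ {A : Set} (f g : A → ℤ) L →
            sumOver (λ a → f a ℤ.+ g a) L ≡ sumOver f L ℤ.+ sumOver g L
sumOver-+ f g []      = refl
sumOver-+ f g (a ∷ L) rewrite sumOver-+ f g L =
  solve 4 (λ p q r s → p :+ q :+ (r :+ s) := p :+ r :+ (q :+ s)) refl
    (f a) (g a) (sumOver f L) (sumOver g L)
  where open +-*-Solver

sumOver-* : ∀ {A : Set} c (f : A → ℤ) L →
            sumOver (λ a → c ℤ.* f a) L ≡ c ℤ.* sumOver f L
sumOver-* c f []      = sym (ℤ.*-zeroʳ c)
sumOver-* c f (a ∷ L) rewrite sumOver-* c f L = sym (ℤ.*-distribˡ-+ c (f a) (sumOver f L))

sumOver-filter : ∀ {A : Set} {P : Pred A 0ℓ} (P? : Decidable₁ P) (f : A → ℤ) L →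
  sumOver f L ≡ sumOver f (filter P? L) ℤ.+ sumOver f (filter (¬? ∘ P?) L)
sumOver-filter P? f [] = refl
sumOver-filter P? f (a ∷ L) with P? a
... | yes _ rewrite sumOver-filter P? f L = sym (ℤ.+-assoc (f a) _ _)
... | no  _ rewrite sumOver-filter P? f L =
  solve 3 (λ p q r → p :+ (q :+ r) := q :+ (p :+ r)) refl
    (f a) (sumOver f (filter P? L)) (sumOver f (filter (¬? ∘ P?) L))
  where open +-*-Solver

filter-⊆ : ∀ {A : Set} {P Q : A → Set} (P? : Decidable₁ P) (Q? : Decidable₁ Q) →
           (∀ {a} → Q a → P a) → ∀ L → filter Q? (filter P? L) ≡ filter Q? L
filter-⊆ P? Q? Q⇒P [] = refl
filter-⊆ P? Q? Q⇒P (a ∷ L) with P? a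
... | yes _  with Q? a
...   | yes _ = cong (a ∷_) (filter-⊆ P? Q? Q⇒P L)
...   | no  _ = filter-⊆ P? Q? Q⇒P L
filter-⊆ P? Q? Q⇒P (a ∷ L) | no ¬p with Q? a
...   | yes q = contradiction (Q⇒P q) ¬p
...   | no  _ = filter-⊆ P? Q? Q⇒P L

module _ {A : Set} {_~_ : Rel A 0ℓ} (_~?_ : Decidable _~_)
         (~-refl : Reflexive _~_) (~-sym : Symmetric _~_) (~-trans : Transitive _~_)
         (f : A → ℤ) where

  -- Removing the class of the head leaves every other class whole, so the hypothesis survives on
  -- `rest`, which is shorter because `a` itself is gone.
  sumOver-classes : ∀ L → (∀ {a} → a ∈ˡ L → 0ℤ ℤ.≤ sumOver f (filter (_~? a) L)) →
                    0ℤ ℤ.≤ sumOver f L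
  sumOver-classes L = go L (<-wellFounded (length L))
    where
    go : ∀ L → Acc _<_ (length L) → (∀ {a} → a ∈ˡ L → 0ℤ ℤ.≤ sumOver f (filter (_~? a) L)) →
         0ℤ ℤ.≤ sumOver f L
    go []         _         _    = ℤ.≤-refl
    go L@(a ∷ L′) (acc rec) 0≤cl =
      subst (0ℤ ℤ.≤_) (sym (sumOver-filter (_~? a) f L))
        (ℤ.+-mono-≤ (0≤cl (here refl)) (go rest (rec shorter) 0≤rest))
      where
      rest : List A
      rest = filter (¬? ∘ (_~? a)) L

      shorter : length rest < length L
      shorter rewrite filter-reject (¬? ∘ (_~? a)) {x = a} {xs = L′} (λ a≁a → a≁a ~-refl) =
        s≤s (length-filter (¬? ∘ (_~? a)) L′)

      0≤rest : ∀ {b} → b ∈ˡ rest → 0ℤ ℤ.≤ sumOver f (filter (_~? b) rest)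
      0≤rest {b} b∈ with b∈L , b≁a ← ∈-filter⁻ (¬? ∘ (_~? a)) {xs = L} b∈ =
        subst (λ M → 0ℤ ℤ.≤ sumOver f M)
          (sym (filter-⊆ (¬? ∘ (_~? a)) (_~? b)
                 (λ x~b x~a → b≁a (~-trans (~-sym x~b) x~a)) L))
          (0≤cl b∈L)

-- Sums over the power set.

sumSubsets : ∀ {n} → (Subset n → ℤ) → ℤ
sumSubsets {zero}  f = f []
sumSubsets {suc n} f = sumSubsets (f ∘ (false ∷_)) ℤ.+ sumSubsets (f ∘ (true ∷_))

sumSubsets-cong : ∀ {n} {f g : Subset n → ℤ} → (∀ u → f u ≡ g u) → sumSubsets f ≡ sumSubsets g
sumSubsets-cong {zero}  f≗g = f≗g []
sumSubsets-cong {suc n} f≗g =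
  cong₂ ℤ._+_ (sumSubsets-cong (f≗g ∘ (false ∷_))) (sumSubsets-cong (f≗g ∘ (true ∷_)))

sumSubsets-mono : ∀ {n} {f g : Subset n → ℤ} → (∀ u → f u ℤ.≤ g u) → sumSubsets f ℤ.≤ sumSubsets g
sumSubsets-mono {zero}  f≤g = f≤g []
sumSubsets-mono {suc n} f≤g =
  ℤ.+-mono-≤ (sumSubsets-mono (f≤g ∘ (false ∷_))) (sumSubsets-mono (f≤g ∘ (true ∷_)))

sumSubsets-+ : ∀ {n} (f g : Subset n → ℤ) →
               sumSubsets (λ u → f u ℤ.+ g u) ≡ sumSubsets f ℤ.+ sumSubsets g
sumSubsets-+ {zero}  f g = refl
sumSubsets-+ {suc n} f g
  rewrite sumSubsets-+ (f ∘ (false ∷_)) (g ∘ (false ∷_))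
        | sumSubsets-+ (f ∘ (true ∷_)) (g ∘ (true ∷_)) =
  solve 4 (λ p q r s → p :+ q :+ (r :+ s) := p :+ r :+ (q :+ s)) refl
    (sumSubsets (f ∘ (false ∷_))) (sumSubsets (g ∘ (false ∷_)))
    (sumSubsets (f ∘ (true ∷_))) (sumSubsets (g ∘ (true ∷_)))
  where open +-*-Solver

sumSubsets-0 : ∀ n → sumSubsets {n} (λ _ → 0ℤ) ≡ 0ℤ
sumSubsets-0 zero    = refl
sumSubsets-0 (suc n) = cong₂ ℤ._+_ (sumSubsets-0 n) (sumSubsets-0 n)

𝟙 : Bool → ℤ
𝟙 b = if b then 1ℤ else 0ℤ

δ : ∀ {n} → Subset n → Subset n → ℤ
δ u v = 𝟙 (does (u ≟ˢ v))

sumSubsets-δ : ∀ {n} u (f : Subset n → ℤ) → sumSubsets (λ v → δ u v ℤ.* f v) ≡ f u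
sumSubsets-δ []          f = ℤ.*-identityˡ (f [])
sumSubsets-δ {suc n} (false ∷ u) f =
  trans (cong₂ ℤ._+_ (sumSubsets-δ u (f ∘ (false ∷_)))
          (trans (sumSubsets-cong (λ v → ℤ.*-zeroˡ (f (true ∷ v)))) (sumSubsets-0 n)))
        (ℤ.+-identityʳ _)
sumSubsets-δ {suc n} (true ∷ u) f =
  trans (cong₂ ℤ._+_ (trans (sumSubsets-cong (λ v → ℤ.*-zeroˡ (f (false ∷ v)))) (sumSubsets-0 n))
          (sumSubsets-δ u (f ∘ (true ∷_))))
        (ℤ.+-identityˡ _)

_∈ˢ?_ : ∀ {n} (u : Subset n) L → Dec (u ∈ˡ L)
u ∈ˢ? L = any? (u ≟ˢ_) L

-- Trades a list for its indicator function, the form in which certificates see a family. The right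
-- side counts a repeated entry only once, hence the uniqueness.
sumOver-unique : ∀ {n} (f : Subset n → ℤ) {L} → Uniqueˡ L →
                 sumOver f L ≡ sumSubsets (λ u → 𝟙 (does (u ∈ˢ? L)) ℤ.* f u)
sumOver-unique {n} f [] = sym (trans (sumSubsets-cong (λ u → ℤ.*-zeroˡ (f u))) (sumSubsets-0 n))
sumOver-unique f {u ∷ L} (u∉L ∷ L!) = begin
  f u ℤ.+ sumOver f L
    ≡⟨ cong₂ ℤ._+_ (sym (sumSubsets-δ u f)) (sumOver-unique f L!) ⟩
  sumSubsets (λ v → δ u v ℤ.* f v) ℤ.+ sumSubsets (λ v → 𝟙 (does (v ∈ˢ? L)) ℤ.* f v)
    ≡⟨ sumSubsets-+ (λ v → δ u v ℤ.* f v) (λ v → 𝟙 (does (v ∈ˢ? L)) ℤ.* f v) ⟨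
  sumSubsets (λ v → δ u v ℤ.* f v ℤ.+ 𝟙 (does (v ∈ˢ? L)) ℤ.* f v)
    ≡⟨ sumSubsets-cong split ⟩
  sumSubsets (λ v → 𝟙 (does (v ∈ˢ? (u ∷ L))) ℤ.* f v) ∎
  where
  open ≡-Reasoning
  split : ∀ v → δ u v ℤ.* f v ℤ.+ 𝟙 (does (v ∈ˢ? L)) ℤ.* f v ≡ 𝟙 (does (v ∈ˢ? (u ∷ L))) ℤ.* f v
  split v with v ≟ˢ u
  ... | yes refl rewrite dec-true (u ≟ˢ u) refl
                       | dec-false (u ∈ˢ? L) (λ u∈L → All.lookup u∉L u∈L refl) = ℤ.+-identityʳ _
  ... | no  v≢u  rewrite dec-false (u ≟ˢ v) (v≢u ∘ sym) =
    ℤ.+-identityˡ (𝟙 (does (v ∈ˢ? L)) ℤ.* f v)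

-- Weighted balance of a family.

sign : Bool → ℤ
sign b = if b then 1ℤ else -1ℤ

-- For the set Y coded by `u` this is c(Y) - c([n] - Y).
balance : ∀ {n} → Vec ℕ n → Subset n → ℤ
balance []       []      = 0ℤ
balance (c ∷ cs) (b ∷ u) = + c ℤ.* sign b ℤ.+ balance cs u

sumOver-sign : ∀ i F → sumOver (λ A → sign (does (i ∈? A))) F ≡
               + 2 ℤ.* + length (F at i) ℤ.- + length F
sumOver-sign i [] = refl
sumOver-sign i (A ∷ F) with i ∈? A
... | yes _ rewrite sumOver-sign i F =
  solve 2 (λ l m → con 1ℤ :+ (con (+ 2) :* l :- m) := con (+ 2) :* (con 1ℤ :+ l) :- (con 1ℤ :+ m)) refl
          (+ length (F at i)) (+ length F)
  where open +-*-Solver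
... | no  _ rewrite sumOver-sign i F =
  solve 2 (λ l m → con -1ℤ :+ (con (+ 2) :* l :- m) := con (+ 2) :* l :- (con 1ℤ :+ m)) refl
          (+ length (F at i)) (+ length F)
  where open +-*-Solver

sumOver-sign-≤ : ∀ i F → 2 * length (F at i) < length F →
                 sumOver (λ A → sign (does (i ∈? A))) F ℤ.≤ -1ℤ
sumOver-sign-≤ i F few = begin
  sumOver (λ A → sign (does (i ∈? A))) F         ≡⟨ sumOver-sign i F ⟩
  + 2 ℤ.* + l ℤ.- + length F                     ≤⟨ ℤ.+-monoʳ-≤ (+ 2 ℤ.* + l) (ℤ.neg-mono-≤ (ℤ.+≤+ few)) ⟩
  + 2 ℤ.* + l ℤ.- + suc (2 * l)                  ≡⟨ cong (λ x → + 2 ℤ.* + l ℤ.- (1ℤ ℤ.+ x)) (ℤ.pos-* 2 l) ⟩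
  + 2 ℤ.* + l ℤ.- (1ℤ ℤ.+ + 2 ℤ.* + l)
    ≡⟨ solve 1 (λ x → x :- (con 1ℤ :+ x) := con -1ℤ) refl (+ 2 ℤ.* + l) ⟩
  -1ℤ                                            ∎
  where
  open ℤ.≤-Reasoning
  open +-*-Solver
  l : ℕ
  l = length (F at i)

-- By integrality each strict inequality leaves a margin of at least one, and the weights add these
-- margins up. The bound is negative as soon as some weight is positive.
sumOver-balance : ∀ {n} (c : Vec ℕ n) F →
                  (∀ i → i ∈ [1⋯ n ] → 2 * length (F at i) < length F) →
                  sumOver (λ A → balance c (trace n A)) F ℤ.≤ ℤ.- (+ Vec.sum c)
sumOver-balance []       F few = ℤ.≤-reflexive (sumOver-0 F)
sumOver-balance {suc n} (c ∷ cs) F few = begin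
  sumOver (λ A → + c ℤ.* s A ℤ.+ balance cs (trace n A)) F
    ≡⟨ sumOver-+ (λ A → + c ℤ.* s A) (balance cs ∘ trace n) F ⟩
  sumOver (λ A → + c ℤ.* s A) F ℤ.+ sumOver (balance cs ∘ trace n) F
    ≡⟨ cong (ℤ._+ sumOver (balance cs ∘ trace n) F) (sumOver-* (+ c) s F) ⟩
  + c ℤ.* sumOver s F ℤ.+ sumOver (balance cs ∘ trace n) F
    ≤⟨ ℤ.+-mono-≤ (ℤ.*-monoˡ-≤-nonNeg (+ c)
                    (sumOver-sign-≤ (suc n) F (few (suc n) (∈-applyUpTo⁺ suc (ℕ.n<1+n n)))))
                  (sumOver-balance cs F λ i i∈ → few i (weaken i∈)) ⟩
  + c ℤ.* -1ℤ ℤ.+ ℤ.- (+ Vec.sum cs)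
    ≡⟨ solve 2 (λ x y → x :* con -1ℤ :- y := :- (x :+ y)) refl (+ c) (+ Vec.sum cs) ⟩
  ℤ.- (+ c ℤ.+ + Vec.sum cs) ∎
  where
  open ℤ.≤-Reasoning
  open +-*-Solver
  s : FinSet → ℤ
  s A = sign (does (suc n ∈? A))

  weaken : ∀ {i} → i ∈ [1⋯ n ] → i ∈ [1⋯ suc n ]
  weaken i∈ with j , j<n , refl ← ∈-applyUpTo⁻ suc i∈ = ∈-applyUpTo⁺ suc (ℕ.m<n⇒m<1+n j<n)

-- Poonen's averaging argument: the members of F agreeing outside [1⋯ n ] form
-- a family whose traces are closed under unions and under adding members of G.

module _ {n : ℕ} (c : Vec ℕ n) (G : Family) (G-bounded : All (All (_∈ [1⋯ n ])) G)
         (nonneg : ∀ (b : Subset n → Bool) →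
                   (∀ u v → T (b u) → T (b v) → T (b (u ⊔ v))) →
                   (∀ {g} → g ∈ˡ G → ∀ u → T (b u) → T (b (trace n g ⊔ u))) →
                   0ℤ ℤ.≤ sumSubsets (λ u → 𝟙 (b u) ℤ.* balance c u))
         {F : Family} (F-uc : UC F) (G⊆F : G ⊆ᶠ F) where

  open UC F-uc

  private
    -- Adding all of `[1⋯ n ]` erases the trace, so equal keys mean equality outside `[1⋯ n ]`,
    -- expressed by unions alone.
    key : FinSet → FinSet
    key A = A ∪ [1⋯ n ]

    _~_ : FinSet → FinSet → Set
    A ~ B = key A ≋ key B

    _~?_ : ∀ A B → Dec (A ~ B)
    A ~? B = key A ≋? key B

    -- Within a class no two distinct sets share a trace, so a sum over the class is a sum over a
    -- repetition-free list of bit strings.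
    trace-injective : ∀ {A B} → A ~ B → trace n A ≡ trace n B → A ≋ B
    trace-injective A~B eq = mk⇔ (half A~B eq) (half (≋.sym A~B) (sym eq))
      where
      half : ∀ {A B} → A ~ B → trace n A ≡ trace n B → ∀ {x} → x ∈ A → x ∈ B
      half {B = B} A~B eq x∈A with ∈-++⁻ B (Equivalence.to A~B (∈-++⁺ˡ x∈A))
      ... | inj₁ x∈B = x∈B
      ... | inj₂ x≤n = trace-reflects n eq x≤n x∈A

    key-∪ : ∀ {A B C} → A ~ C → B ~ C → (A ∪ B) ~ C
    key-∪ {A} {B} {C} A~C B~C = mk⇔ to from
      where
      to : ∀ {x} → x ∈ key (A ∪ B) → x ∈ key C
      to x∈ with ∈-++⁻ (A ∪ B) x∈
      ... | inj₂ x≤n = ∈-++⁺ʳ C x≤n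
      ... | inj₁ x∈A∪B with ∈-++⁻ A x∈A∪B
      ...   | inj₁ x∈A = Equivalence.to A~C (∈-++⁺ˡ x∈A)
      ...   | inj₂ x∈B = Equivalence.to B~C (∈-++⁺ˡ x∈B)
      from : ∀ {x} → x ∈ key C → x ∈ key (A ∪ B)
      from x∈ with ∈-++⁻ A (Equivalence.from A~C x∈)
      ... | inj₁ x∈A = ∈-++⁺ˡ (∈-++⁺ˡ x∈A)
      ... | inj₂ x≤n = ∈-++⁺ʳ (A ∪ B) x≤n

    -- Adding a set inside `[1⋯ n ]` changes nothing outside it. This is why each class absorbs all
    -- of `G`.
    key-bounded : ∀ {g A} → All (_∈ [1⋯ n ]) g → (g ∪ A) ~ A
    key-bounded {g} {A} g≤n = mk⇔ to from
      where
      to : ∀ {x} → x ∈ key (g ∪ A) → x ∈ key A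
      to x∈ with ∈-++⁻ (g ∪ A) x∈
      ... | inj₂ x≤n = ∈-++⁺ʳ A x≤n
      ... | inj₁ x∈g∪A with ∈-++⁻ g x∈g∪A
      ...   | inj₁ x∈g = ∈-++⁺ʳ A (All.lookup g≤n x∈g)
      ...   | inj₂ x∈A = ∈-++⁺ˡ x∈A
      from : ∀ {x} → x ∈ key A → x ∈ key (g ∪ A)
      from x∈ with ∈-++⁻ A x∈
      ... | inj₁ x∈A = ∈-++⁺ˡ (∈-++⁺ʳ g x∈A)
      ... | inj₂ x≤n = ∈-++⁺ʳ (g ∪ A) x≤n

    key-cong : ∀ {A B} → A ≋ B → A ~ B
    key-cong {A} {B} A≋B = mk⇔ (half A≋B) (half (≋.sym A≋B))
      where
      half : ∀ {A B} → A ≋ B → ∀ {x} → x ∈ key A → x ∈ key B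
      half {A} {B} A≋B x∈ with ∈-++⁻ A x∈
      ... | inj₁ x∈A = ∈-++⁺ˡ (Equivalence.to A≋B x∈A)
      ... | inj₂ x≤n = ∈-++⁺ʳ B x≤n

    class : FinSet → Family
    class A = filter (_~? A) F

    traces : FinSet → List (Subset n)
    traces A = map (trace n) (class A)

    traces-∋ : ∀ {A B} → B ∈ᶠ F → B ~ A → trace n B ∈ˡ traces A
    traces-∋ {A} {B} B∈F B~A with C , C∈F , B≋C ← find B∈F =
      subst (_∈ˡ traces A) (sym (trace-cong n B≋C))
        (∈-map⁺ (trace n) (∈-filter⁺ (_~? A) C∈F (≋.trans (≋.sym (key-cong B≋C)) B~A)))

    traces-∌ : ∀ {A u} → u ∈ˡ traces A → ∃[ B ] B ∈ᶠ F × B ~ A × u ≡ trace n B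
    traces-∌ {A} u∈ with B , B∈ , eq ← ∈-map⁻ (trace n) u∈
                    with B∈F , B~A ← ∈-filter⁻ (_~? A) {xs = F} B∈ = B , lose B∈F ≋.refl , B~A , eq

    traces-unique : ∀ A → Uniqueˡ (traces A)
    traces-unique A = AllPairs.map⁺ (go (All.all-filter (_~? A) F) (AllPairs.filter⁺ (_~? A) distinct))
      where
      go : ∀ {H} → All (_~ A) H → AllPairs (λ B C → ¬ (B ≋ C)) H →
           AllPairs (λ B C → trace n B ≢ trace n C) H
      go []           []            = []
      go (B~A ∷ H~A) (B≉H ∷ H!) =
        All.zipWith (λ { (C~A , B≉C) eq → B≉C (trace-injective (≋.trans B~A (≋.sym C~A)) eq) })
          (H~A , B≉H) ∷ go H~A H!

    class-nonneg : ∀ A → 0ℤ ℤ.≤ sumOver (balance c ∘ trace n) (class A)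
    class-nonneg A = subst (0ℤ ℤ.≤_)
      (trans (sumSubsets-cong (λ u → cong (λ b → 𝟙 b ℤ.* balance c u) (isYes≗does (u ∈ˢ? traces A))))
      (trans (sym (sumOver-unique (balance c) (traces-unique A)))
             (sumOver-map (balance c) (trace n) (class A))))
      (nonneg (λ u → isYes (u ∈ˢ? traces A)) closed absorbing)
      where
      closed : ∀ u v → True (u ∈ˢ? traces A) → True (v ∈ˢ? traces A) → True ((u ⊔ v) ∈ˢ? traces A)
      closed u v bu bv
        with B , B∈F , B~A , refl ← traces-∌ {A} {u} (toWitness bu)
           | C , C∈F , C~A , refl ← traces-∌ {A} {v} (toWitness bv) =
        fromWitness (subst (_∈ˡ traces A) (trace-∪ n B C)
          (traces-∋ (∪-closed B C B∈F C∈F) (key-∪ {B} {C} {A} B~A C~A)))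
      absorbing : ∀ {g} → g ∈ˡ G → ∀ u → True (u ∈ˢ? traces A) → True ((trace n g ⊔ u) ∈ˢ? traces A)
      absorbing {g} g∈G u bu with B , B∈F , B~A , refl ← traces-∌ {A} {u} (toWitness bu) =
        fromWitness (subst (_∈ˡ traces A) (trace-∪ n g B)
          (traces-∋ (∪-closed g B (G⊆F (lose g∈G ≋.refl)) B∈F)
            (≋.trans (key-bounded {g} {B} (All.lookup G-bounded g∈G)) B~A)))

  averaging : (∀ i → i ∈ [1⋯ n ] → 2 * length (F at i) < length F) → 0ℤ ℤ.≤ ℤ.- (+ Vec.sum c)
  averaging few = ℤ.≤-trans
    (sumOver-classes _~?_ ≋.refl ≋.sym ≋.trans (balance c ∘ trace n) F (λ {A} _ → class-nonneg A))
    (sumOver-balance c F few)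

-- Certificates for nonnegative sums over union-closed families.

decode : ∀ n → ℕ → Subset n
decode zero    _ = []
decode (suc n) k =
  if 2 ^ n ≤ᵇ k then true ∷ decode n (k ∸ 2 ^ n) else false ∷ decode n k

-- Certificates that Σ φ over a family b is nonnegative.  A branch decides whether
-- a set p lies in b.  At a leaf, (u , t , f) moves the amount f of φ from t ⊔ u to
-- u, which cannot increase the sum if b absorbs t.  Sets are given in binary,
-- element i contributing 2 ^ (i ∸ 1).

data Certificate : Set where
  branch : ℕ → Certificate → Certificate → Certificate
  flow   : List (ℕ × ℕ × ℕ) → Certificate

module _ {n : ℕ} where

  Flow : Set
  Flow = Subset n × Subset n × ℕ

  shift : (Subset n → ℤ) → Flow → Subset n → ℤ
  shift φ (u , t , f) v = φ v ℤ.+ + f ℤ.* (δ u v ℤ.- δ (t ⊔ u) v)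

  -- The least value `𝟙 (b v) ℤ.* φ v` can take when all that is known of `b` is that it contains
  -- `ins` and misses `outs`. Its sum is therefore a bound that no longer mentions `b`.
  lower : List (Subset n) → List (Subset n) → (Subset n → ℤ) → Subset n → ℤ
  lower ins outs φ v =
    if does (v ∈ˢ? outs) then 0ℤ else if does (v ∈ˢ? ins) then φ v else φ v ℤ.⊓ 0ℤ

  flows : List (ℕ × ℕ × ℕ) → List Flow
  flows = map λ (u , t , f) → decode n u , decode n t , f

  Valid : (ts ins outs : List (Subset n)) → (Subset n → ℤ) → Certificate → Set
  Valid ts ins outs φ (branch p C D) =
    Valid ts (decode n p ∷ ins) outs φ C × Valid ts ins (decode n p ∷ outs) φ D
  Valid ts ins outs φ (flow fs) =
    All (λ (_ , t , _) → t ∈ˡ ins ++ ts) (flows fs) ×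
    0ℤ ℤ.≤ sumSubsets (lower ins outs (foldl shift φ (flows fs)))

  valid? : ∀ ts ins outs φ C → Dec (Valid ts ins outs φ C)
  valid? ts ins outs φ (branch p C D) =
    valid? ts (decode n p ∷ ins) outs φ C ×-dec valid? ts ins (decode n p ∷ outs) φ D
  valid? ts ins outs φ (flow fs) =
    all? (λ (_ , t , _) → t ∈ˢ? (ins ++ ts)) (flows fs) ×-dec (0ℤ ℤ.≤? _)

  module _ (b : Subset n → Bool) where

    Absorbs : Subset n → Set
    Absorbs t = ∀ u → T (b u) → T (b (t ⊔ u))

    value : (Subset n → ℤ) → ℤ
    value φ = sumSubsets λ u → 𝟙 (b u) ℤ.* φ u

    -- The value changes by `f` times `𝟙 (b u) ℤ.- 𝟙 (b (t ⊔ u))`. This could be positive only with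
    -- `u` in `b` and `t ⊔ u` outside, which absorption excludes.
    shift-≤ : ∀ φ {u t} f → Absorbs t → value (shift φ (u , t , f)) ℤ.≤ value φ
    shift-≤ φ {u} {t} f absorbs = begin
      value (shift φ (u , t , f))
        ≡⟨ sumSubsets-cong (λ v → solve 5 (λ β x f d e → β :* (x :+ f :* (d :- e)) :=
             β :* x :+ (d :* (f :* β) :+ e :* ((:- f) :* β))) refl
             (𝟙 (b v)) (φ v) (+ f) (δ u v) (δ (t ⊔ u) v)) ⟩
      sumSubsets (λ v → 𝟙 (b v) ℤ.* φ v ℤ.+ (P v ℤ.+ Q v))
        ≡⟨ trans (sumSubsets-+ (λ v → 𝟙 (b v) ℤ.* φ v) (λ v → P v ℤ.+ Q v))
             (cong (ℤ._+_ (value φ)) (trans (sumSubsets-+ P Q)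
               (cong₂ ℤ._+_ (sumSubsets-δ u _) (sumSubsets-δ (t ⊔ u) _)))) ⟩
      value φ ℤ.+ (+ f ℤ.* 𝟙 (b u) ℤ.+ (ℤ.- + f) ℤ.* 𝟙 (b (t ⊔ u)))
        ≤⟨ ℤ.+-monoʳ-≤ (value φ) (gain (b u) (b (t ⊔ u)) (absorbs u)) ⟩
      value φ ℤ.+ 0ℤ
        ≡⟨ ℤ.+-identityʳ (value φ) ⟩
      value φ ∎
      where
      open ℤ.≤-Reasoning
      open +-*-Solver
      P Q : Subset n → ℤ
      P v = δ u v ℤ.* (+ f ℤ.* 𝟙 (b v))
      Q v = δ (t ⊔ u) v ℤ.* ((ℤ.- + f) ℤ.* 𝟙 (b v))

      gain : ∀ x y → (T x → T y) → + f ℤ.* 𝟙 x ℤ.+ (ℤ.- + f) ℤ.* 𝟙 y ℤ.≤ 0ℤ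
      gain true true _ = ℤ.≤-reflexive
        (solve 1 (λ f → f :* con 1ℤ :+ (:- f) :* con 1ℤ := con 0ℤ) refl (+ f))
      gain true false x⇒y = contradiction (x⇒y tt) λ ()
      gain false false _ = ℤ.≤-reflexive
        (solve 1 (λ f → f :* con 0ℤ :+ (:- f) :* con 0ℤ := con 0ℤ) refl (+ f))
      gain false true _ = begin
        + f ℤ.* 0ℤ ℤ.+ (ℤ.- + f) ℤ.* 1ℤ
          ≡⟨ solve 1 (λ f → f :* con 0ℤ :+ (:- f) :* con 1ℤ := :- f) refl (+ f) ⟩
        ℤ.- + f
          ≤⟨ ℤ.neg-mono-≤ (ℤ.+≤+ z≤n) ⟩
        0ℤ ∎

    shifts-≤ : ∀ φ fs → All (λ (_ , t , _) → Absorbs t) fs → value (foldl shift φ fs) ℤ.≤ value φ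
    shifts-≤ φ []       []                 = ℤ.≤-refl
    shifts-≤ φ (fl@(u , t , f) ∷ fs) (absorbs ∷ rest) =
      ℤ.≤-trans (shifts-≤ (shift φ fl) fs rest) (shift-≤ φ {u} f absorbs)

    lower-≤ : ∀ {ins outs} φ → All (T ∘ b) ins → All (λ u → ¬ T (b u)) outs →
              sumSubsets (lower ins outs φ) ℤ.≤ value φ
    lower-≤ {ins} {outs} φ ins⊆ outs⊈ = sumSubsets-mono pointwise
      where
      pointwise : ∀ v → lower ins outs φ v ℤ.≤ 𝟙 (b v) ℤ.* φ v
      pointwise v with v ∈ˢ? outs
      ... | yes v∈ with b v | All.lookup outs⊈ v∈
      ...   | true  | ¬tt = contradiction tt ¬tt
      ...   | false | _   = ℤ.≤-refl
      pointwise v | no _ with v ∈ˢ? ins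
      ... | yes v∈ with b v | All.lookup ins⊆ v∈
      ...   | true | _ = ℤ.≤-reflexive (sym (ℤ.*-identityˡ (φ v)))
      pointwise v | no _ | no _ with b v
      ... | true  = ℤ.≤-trans (ℤ.i⊓j≤i (φ v) 0ℤ) (ℤ.≤-reflexive (sym (ℤ.*-identityˡ (φ v))))
      ... | false = ℤ.i⊓j≤j (φ v) 0ℤ

    -- Closure under unions enters only through sets decided to lie in `b`: such a set is absorbed
    -- just as a generator is, so flows may use both kinds alike.
    certified : (∀ u v → T (b u) → T (b v) → T (b (u ⊔ v))) →
                ∀ {ts ins outs} φ C → Valid ts ins outs φ C →
                All Absorbs ts → All (T ∘ b) ins → All (λ u → ¬ T (b u)) outs →
                0ℤ ℤ.≤ value φ
    certified closed {ins = ins} φ (branch p C D) (vC , vD) ts✓ ins✓ outs✓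
      with Bool.T? (b (decode n p))
    ... | yes p∈ = certified closed φ C vC ts✓ (p∈ ∷ ins✓) outs✓
    ... | no  p∉ = certified closed φ D vD ts✓ ins✓ (p∉ ∷ outs✓)
    certified closed {ts} {ins} φ (flow fs) (ts∋ , 0≤) ts✓ ins✓ outs✓ =
      ℤ.≤-trans 0≤ (ℤ.≤-trans (lower-≤ (foldl shift φ (flows fs)) ins✓ outs✓)
        (shifts-≤ φ (flows fs) (All.map absorbs ts∋)))
      where
      absorbs : ∀ {t} → t ∈ˡ ins ++ ts → Absorbs t
      absorbs t∈ with ∈-++⁻ ins t∈
      ... | inj₁ t∈ins = λ u → closed _ u (All.lookup ins✓ t∈ins)
      ... | inj₂ t∈ts  = All.lookup ts✓ t∈ts

-- Deciding what a family generates, and minimality of generators.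

infix 4 _∈ᶠ?_

_∈ᶠ?_ : ∀ A F → Dec (A ∈ᶠ F)
A ∈ᶠ? F = any? (A ≋?_) F

∪-cong : ∀ {A A′ B B′} → A ≋ A′ → B ≋ B′ → (A ∪ B) ≋ (A′ ∪ B′)
∪-cong A≋A′ B≋B′ = mk⇔ (half A≋A′ B≋B′) (half (≋.sym A≋A′) (≋.sym B≋B′))
  where
  half : ∀ {A A′ B B′} → A ≋ A′ → B ≋ B′ → ∀ {x} → x ∈ A ∪ B → x ∈ A′ ∪ B′
  half {A} {A′} A≋A′ B≋B′ x∈ with ∈-++⁻ A x∈
  ... | inj₁ x∈A = ∈-++⁺ˡ (Equivalence.to A≋A′ x∈A)
  ... | inj₂ x∈B = ∈-++⁺ʳ A′ (Equivalence.to B≋B′ x∈B)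

∈ᶠ-resp : ∀ {A B F} → A ≋ B → A ∈ᶠ F → B ∈ᶠ F
∈ᶠ-resp = Membership.∈-resp-≈ finSetSetoid

-- `∪-closed` ranges over all lists equal to a member up to `_≋_`. Passing to representatives turns
-- it into a finite check.
uc : ∀ {F} → ∃[ A ] A ∈ᶠ F → Distinct F →
     All (λ A → All (λ B → (A ∪ B) ∈ᶠ F) F) F → UC F
uc inhabited distinct closed = record
  { nonempty = inhabited
  ; distinct = distinct
  ; ∪-closed = λ A B A∈F B∈F →
      let A′ , A′∈F , A≋A′ = find A∈F
          B′ , B′∈F , B≋B′ = find B∈F
      in ∈ᶠ-resp (≋.sym (∪-cong A≋A′ B≋B′)) (All.lookup (All.lookup closed A′∈F) B′∈F)
  }

uc? : ∀ F → Dec (UC F)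
uc? []        = no λ F-uc → case (proj₂ (UC.nonempty F-uc))
  where
  case : ∀ {A} → ¬ (A ∈ᶠ [])
  case ()
uc? F@(A ∷ _) = map′
  (λ (distinct , closed) → uc (A , here ≋.refl) distinct closed)
  (λ F-uc → UC.distinct F-uc ,
    All.tabulate λ B∈F → All.tabulate λ C∈F →
      UC.∪-closed F-uc _ _ (lose B∈F ≋.refl) (lose C∈F ≋.refl))
  (allPairs? (λ B C → ¬? (B ≋? C)) F ×-dec all? (λ B → all? (λ C → (B ∪ C) ∈ᶠ? F) F) F)

module _ {G : Family} (G-uc : UC G) (∅∈G : ∅ ∈ᶠ G) where

  U-closed : ∀ {S} → S ⊆ᶠ G → U S ∈ᶠ G
  U-closed {[]}    _   = ∅∈G
  U-closed {A ∷ S} S⊆G =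
    UC.∪-closed G-uc A (U S) (S⊆G (here ≋.refl)) (U-closed {S} (λ B∈S → S⊆G (there B∈S)))

module _ (S : Family) where

  below : FinSet → Family
  below A = filter (_⊆? A) S

  -- A decidable stand-in for `_GeneratorOf_`, whose field `least` quantifies over all UC families:
  -- each member of `F` is the union of the generators inside it, hence lies in every UC family
  -- containing `S`. The clause `∅ ∈ᶠ S` supplies the empty union.
  Generates : Family → Set
  Generates F = UC F × All (_∈ᶠ F) S × ∅ ∈ᶠ S × All (λ A → A ≋ U (below A)) F

  generates? : ∀ F → Dec (Generates F)
  generates? F =
    uc? F ×-dec all? (_∈ᶠ? F) S ×-dec (∅ ∈ᶠ? S) ×-dec all? (λ A → A ≋? U (below A)) F

  generates : ∀ {F} → Generates F → S GeneratorOf F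
  generates {F} (F-uc , S⊆F , ∅∈S , spanned) = record
    { uc       = F-uc
    ; contains = λ A∈S → let B , B∈S , A≋B = find A∈S in ∈ᶠ-resp (≋.sym A≋B) (All.lookup S⊆F B∈S)
    ; least    = λ G G-uc S⊆G A∈F →
        let B , B∈F , A≋B = find A∈F
        in ∈ᶠ-resp (≋.sym (≋.trans A≋B (All.lookup spanned B∈F)))
             (U-closed G-uc (S⊆G ∅∈S) λ C∈ →
               let D , D∈ , C≋D = find C∈
               in S⊆G (∈ᶠ-resp (≋.sym C≋D) (lose (proj₁ (∈-filter⁻ (_⊆? B) {xs = S} D∈)) ≋.refl)))
    }

∈-∖⁻ : ∀ {A B} F → A ∈ᶠ F ∖ B → ¬ (A ≋ B)
∈-∖⁻ {A} {B} F A∈ A≋B with C , C∈ , A≋C ← find A∈ =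
  proj₂ (∈-filter⁻ (λ D → ¬? (D ≋? B)) {xs = F} C∈) (≋.trans (≋.sym A≋C) A≋B)

∈-∖⁺ : ∀ {A B F} → A ∈ᶠ F → ¬ (A ≋ B) → A ∈ᶠ F ∖ B
∈-∖⁺ {A} {B} A∈F A≉B with C , C∈F , A≋C ← find A∈F =
  lose (∈-filter⁺ (λ D → ¬? (D ≋? B)) C∈F (λ C≋B → A≉B (≋.trans A≋C C≋B))) A≋C

-- A set whose removal leaves a UC family lies in every generator.

minimal : ∀ {S F} → S GeneratorOf F → All (λ A → UC (F ∖ A)) S → S MinimalGeneratorOf F
minimal {S} {F} S-gen removable = S-gen , λ T (T⊆S , S⊈T) T-gen → S⊈T λ A∈S →
  let B , B∈S , A≋B = find A∈S in ∈ᶠ-resp (≋.sym A≋B) (needed T T⊆S T-gen B∈S)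
  where
  needed : ∀ T → T ⊆ᶠ S → T GeneratorOf F → ∀ {A} → A ∈ˡ S → A ∈ᶠ T
  needed T T⊆S T-gen {A} A∈S with A ∈ᶠ? T
  ... | yes A∈T = A∈T
  ... | no  A∉T = ⊥-elim
    (∈-∖⁻ {A} {A} F (_GeneratorOf_.least T-gen (F ∖ A) (All.lookup removable A∈S)
      (λ B∈T → ∈-∖⁺ {F = F} (_GeneratorOf_.contains T-gen B∈T) λ B≋A → A∉T (∈ᶠ-resp B≋A B∈T))
      (_GeneratorOf_.contains S-gen (lose A∈S ≋.refl))) ≋.refl)

-- From bit strings back to finite sets.

setOf : ∀ {n} → Subset n → FinSet
setOf []                = ∅
setOf {suc n} (true ∷ u)  = suc n ∷ setOf u
setOf         (false ∷ u) = setOf u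

setOf-bounded : ∀ {n} (u : Subset n) {x} → x ∈ setOf u → x ≤ n
setOf-bounded (true ∷ u)  (here refl) = ℕ.≤-refl
setOf-bounded (true ∷ u)  (there x∈)  = ℕ.m≤n⇒m≤1+n (setOf-bounded u x∈)
setOf-bounded (false ∷ u) x∈          = ℕ.m≤n⇒m≤1+n (setOf-bounded u x∈)

setOf-⊔⁻ : ∀ {n} (u v : Subset n) {x} → x ∈ setOf (u ⊔ v) → x ∈ setOf u ∪ setOf v
setOf-⊔⁻ (true ∷ u)  (b ∷ v)     (here refl) = here refl
setOf-⊔⁻ (true ∷ u)  (true ∷ v)  (there x∈) with ∈-++⁻ (setOf u) (setOf-⊔⁻ u v x∈)
... | inj₁ x∈u = there (∈-++⁺ˡ x∈u)
... | inj₂ x∈v = there (∈-++⁺ʳ (setOf u) (there x∈v))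
setOf-⊔⁻ (true ∷ u)  (false ∷ v) (there x∈)  = there (setOf-⊔⁻ u v x∈)
setOf-⊔⁻ (false ∷ u) (true ∷ v)  (here refl) = ∈-++⁺ʳ (setOf u) (here refl)
setOf-⊔⁻ (false ∷ u) (true ∷ v)  (there x∈) with ∈-++⁻ (setOf u) (setOf-⊔⁻ u v x∈)
... | inj₁ x∈u = ∈-++⁺ˡ x∈u
... | inj₂ x∈v = ∈-++⁺ʳ (setOf u) (there x∈v)
setOf-⊔⁻ (false ∷ u) (false ∷ v) x∈          = setOf-⊔⁻ u v x∈
setOf-⊔⁻ []          []          ()

setOf-⊔⁺ˡ : ∀ {n} (u v : Subset n) {x} → x ∈ setOf u → x ∈ setOf (u ⊔ v)
setOf-⊔⁺ˡ (true ∷ u)  (b ∷ v)     (here refl) = here refl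
setOf-⊔⁺ˡ (true ∷ u)  (b ∷ v)     (there x∈)  = there (setOf-⊔⁺ˡ u v x∈)
setOf-⊔⁺ˡ (false ∷ u) (true ∷ v)  x∈          = there (setOf-⊔⁺ˡ u v x∈)
setOf-⊔⁺ˡ (false ∷ u) (false ∷ v) x∈          = setOf-⊔⁺ˡ u v x∈

setOf-⊔ : ∀ {n} (u v : Subset n) → setOf (u ⊔ v) ≋ (setOf u ∪ setOf v)
setOf-⊔ u v = mk⇔ (setOf-⊔⁻ u v) λ x∈ →
  [ setOf-⊔⁺ˡ u v , (λ x∈v → subst (λ w → _ ∈ setOf w) (⊔-comm v u) (setOf-⊔⁺ˡ v u x∈v)) ]′
    (∈-++⁻ (setOf u) x∈)

top∉ : ∀ {n} (u : Subset n) → ¬ (suc n ∈ setOf u)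
top∉ u x∈ = ℕ.1+n≰n (setOf-bounded u x∈)

setOf-injective : ∀ {n} (u v : Subset n) → setOf u ≋ setOf v → u ≡ v
setOf-injective []          []          _   = refl
setOf-injective (true ∷ u)  (true ∷ v)  u≋v = cong (true ∷_) (setOf-injective u v (mk⇔
  (λ x∈ → drop-top u (Equivalence.to u≋v (there x∈)) x∈)
  (λ x∈ → drop-top v (Equivalence.from u≋v (there x∈)) x∈)))
  where
  drop-top : ∀ {n} (u : Subset n) {B x} → x ∈ suc n ∷ B → x ∈ setOf u → x ∈ B
  drop-top u (here refl) x∈u = contradiction x∈u (top∉ u)
  drop-top u (there x∈B) _   = x∈B
setOf-injective (true ∷ u)  (false ∷ v) u≋v = contradiction (Equivalence.to u≋v (here refl)) (top∉ v)
setOf-injective (false ∷ u) (true ∷ v)  u≋v = contradiction (Equivalence.from u≋v (here refl)) (top∉ u)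
setOf-injective (false ∷ u) (false ∷ v) u≋v = cong (false ∷_) (setOf-injective u v u≋v)

bit : ∀ {n} → ℕ → Subset n → Bool
bit i []                = false
bit {suc n} i (b ∷ u) = if i ≡ᵇ suc n then b else bit i u

bit-setOf : ∀ {n} i (u : Subset n) → does (i ∈? setOf u) ≡ bit i u
bit-setOf i [] = refl
bit-setOf {suc n} i (b ∷ u) with i ≡ᵇ suc n in eq
bit-setOf {suc n} i (true ∷ u)  | true rewrite eq = refl
bit-setOf {suc n} i (true ∷ u)  | false rewrite eq = bit-setOf i u
bit-setOf {suc n} i (false ∷ u) | true
  rewrite ℕ.≡ᵇ⇒≡ i (suc n) (subst T (sym eq) tt) = dec-false (suc n ∈? setOf u) (top∉ u)
bit-setOf {suc n} i (false ∷ u) | false = bit-setOf i u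

-- Closure and absorption under products and layers.

Absorbed : ∀ {n} → List (Subset n) → List (Subset n) → Set
Absorbed E D = ∀ e d → e ∈ˡ E → d ∈ˡ D → e ⊔ d ∈ˡ D

absorbed? : ∀ {n} (E D : List (Subset n)) → Dec (Absorbed E D)
absorbed? E D = map′
  (λ all e d e∈ d∈ → All.lookup (All.lookup all e∈) d∈)
  (λ absorbed → All.tabulate λ e∈ → All.tabulate λ d∈ → absorbed _ _ e∈ d∈)
  (all? (λ e → all? (λ d → (e ⊔ d) ∈ˢ? D) D) E)

-- Closure is self-absorption, so a lemma on how a construction preserves `Absorbed` covers closure
-- as well.
Closed : ∀ {n} → List (Subset n) → Set
Closed L = Absorbed L L

setOf-uc : ∀ {n} {L : List (Subset n)} {u} → u ∈ˡ L → Uniqueˡ L → Closed L → UC (map setOf L)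
setOf-uc {L = L} u∈L L! closed = uc (_ , lose (∈-map⁺ setOf u∈L) ≋.refl)
  (AllPairs.map⁺ (AllPairs.map (λ {u} {v} → distinct u v) L!))
  (All.tabulate λ A∈ → All.tabulate λ B∈ → pair A∈ B∈)
  where
  distinct : ∀ u v → u ≢ v → ¬ (setOf u ≋ setOf v)
  distinct u v u≢v u≋v = u≢v (setOf-injective u v u≋v)

  pair : ∀ {A B} → A ∈ˡ map setOf L → B ∈ˡ map setOf L → (A ∪ B) ∈ᶠ map setOf L
  pair A∈ B∈ with u , u∈ , refl ← ∈-map⁻ setOf A∈ | v , v∈ , refl ← ∈-map⁻ setOf B∈ =
    lose (∈-map⁺ setOf (closed u v u∈ v∈)) (≋.sym (setOf-⊔ u v))

unique? : ∀ {n} (L : List (Subset n)) → Dec (Uniqueˡ L)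
unique? = allPairs? λ u v → ¬? (u ≟ˢ v)

++-⊔ : ∀ {m n} (s t : Subset m) (u v : Subset n) →
       (s Vec.++ u) ⊔ (t Vec.++ v) ≡ (s ⊔ t) Vec.++ (u ⊔ v)
++-⊔ s t u v = Vec.zipWith-++ _∨_ s u t v

infixr 5 _⊠_

_⊠_ : ∀ {m n} → List (Subset m) → List (Subset n) → List (Subset (m + n))
_⊠_ = cartesianProductWith Vec._++_

⊠-absorbed : ∀ {m n} {K L : List (Subset m)} {E D : List (Subset n)} →
             Absorbed K L → Absorbed E D → Absorbed (K ⊠ E) (L ⊠ D)
⊠-absorbed {K = K} {L} {E} {D} K≤L E≤D _ _ x∈ y∈
  with s , u , s∈ , u∈ , refl ← ∈-cartesianProductWith⁻ Vec._++_ K E x∈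
     | t , v , t∈ , v∈ , refl ← ∈-cartesianProductWith⁻ Vec._++_ L D y∈ =
  subst (_∈ˡ L ⊠ D) (sym (++-⊔ s t u v))
    (∈-cartesianProductWith⁺ Vec._++_ (K≤L s t s∈ t∈) (E≤D u v u∈ v∈))

⊠-unique : ∀ {m n} {K : List (Subset m)} {L : List (Subset n)} →
           Uniqueˡ K → Uniqueˡ L → Uniqueˡ (K ⊠ L)
⊠-unique = Unique.cartesianProductWith⁺ Vec._++_ (λ {w} {x} eq → Vec.++-injective w x eq)

layers : ∀ {n} → List (Subset n) → List (Subset n) → List (Subset (suc n))
layers K L = map (false ∷_) K ++ map (true ∷_) L

module _ {n : ℕ} {K L : List (Subset n)} where

  low⁺ : ∀ {u} → u ∈ˡ K → false ∷ u ∈ˡ layers K L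
  low⁺ u∈ = ∈-++⁺ˡ (∈-map⁺ (false ∷_) u∈)

  high⁺ : ∀ {u} → u ∈ˡ L → true ∷ u ∈ˡ layers K L
  high⁺ u∈ = ∈-++⁺ʳ (map (false ∷_) K) (∈-map⁺ (true ∷_) u∈)

  layers⁻ : ∀ {b u} → b ∷ u ∈ˡ layers K L → (b ≡ false × u ∈ˡ K) ⊎ (b ≡ true × u ∈ˡ L)
  layers⁻ x∈ with ∈-++⁻ (map (false ∷_) K) x∈
  ... | inj₁ x∈low  with _ , u∈ , refl ← ∈-map⁻ (false ∷_) x∈low = inj₁ (refl , u∈)
  ... | inj₂ x∈high with _ , u∈ , refl ← ∈-map⁻ (true ∷_) x∈high = inj₂ (refl , u∈)

  layers-unique : Uniqueˡ K → Uniqueˡ L → Uniqueˡ (layers K L)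
  layers-unique K! L! =
    Unique.++⁺ (Unique.map⁺ Vec.∷-injectiveʳ K!) (Unique.map⁺ Vec.∷-injectiveʳ L!) λ (x∈K , x∈L) →
      false≢true (cong Vec.head
        (trans (sym (proj₂ (proj₂ (∈-map⁻ (false ∷_) x∈K)))) (proj₂ (proj₂ (∈-map⁻ (true ∷_) x∈L)))))
    where
    false≢true : ¬ (false ≡ true)
    false≢true ()

  -- The gluing principle behind both `stack` and `tower`: a union of strings from different layers
  -- has leading bit `true`, so the upper layer has to absorb the lower one.
  layers-closed : Closed K → Closed L → Absorbed K L → Closed (layers K L)
  layers-closed K-closed L-closed K≤L (a ∷ u) (b ∷ v) x∈ y∈ with layers⁻ x∈ | layers⁻ y∈
  ... | inj₁ (refl , u∈) | inj₁ (refl , v∈) = low⁺ (K-closed u v u∈ v∈)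
  ... | inj₁ (refl , u∈) | inj₂ (refl , v∈) = high⁺ (K≤L u v u∈ v∈)
  ... | inj₂ (refl , u∈) | inj₁ (refl , v∈) = high⁺ (subst (_∈ˡ L) (⊔-comm v u) (K≤L v u v∈ u∈))
  ... | inj₂ (refl , u∈) | inj₂ (refl , v∈) = high⁺ (L-closed u v u∈ v∈)

subsets : ∀ n → List (Subset n)
subsets zero    = [] ∷ []
subsets (suc n) = layers (subsets n) (subsets n)

∈-subsets : ∀ {n} (u : Subset n) → u ∈ˡ subsets n
∈-subsets []          = here refl
∈-subsets (false ∷ u) = low⁺ (∈-subsets u)
∈-subsets (true ∷ u)  = high⁺ {K = subsets _} (∈-subsets u)

subsets-unique : ∀ n → Uniqueˡ (subsets n)
subsets-unique zero    = [] ∷ []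
subsets-unique (suc n) = layers-unique (subsets-unique n) (subsets-unique n)

-- Stacking families over marker elements.

pad : ∀ {m n} → Subset m → List (Subset n) → List (Subset (m + n))
pad s = map (s Vec.++_)

pad-unique : ∀ {m n} (s : Subset m) {D : List (Subset n)} → Uniqueˡ D → Uniqueˡ (pad s D)
pad-unique s = Unique.map⁺ (Vec.++-injectiveʳ s s)

pad-absorbed : ∀ {m n} {s t : Subset m} → s ⊔ t ≡ t → ∀ {E D : List (Subset n)} →
               Absorbed E D → Absorbed (pad s E) (pad t D)
pad-absorbed {s = s} {t} s⊔t≡t {E} {D} E≤D _ _ x∈ y∈
  with e , e∈ , refl ← ∈-map⁻ (s Vec.++_) x∈ | d , d∈ , refl ← ∈-map⁻ (t Vec.++_) y∈ =
  subst (_∈ˡ pad t D) (sym (trans (++-⊔ s t e d) (cong (Vec._++ (e ⊔ d)) s⊔t≡t)))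
    (∈-map⁺ (t Vec.++_) (E≤D e d e∈ d∈))

-- Every D gets a marker element missing from its members only, so that a union
-- of members of different D's contains all markers and lies in the top layer,
-- where everything is allowed.

stack : ∀ {n} (Ds : List (List (Subset n))) → List (Subset (length Ds + n))
stack {n} []   = subsets n
stack (D ∷ Ds) = layers (pad (⊤ {length Ds}) D) (stack Ds)

module _ {n : ℕ} where

  full∈stack : ∀ (Ds : List (List (Subset n))) x → ⊤ {length Ds} Vec.++ x ∈ˡ stack Ds
  full∈stack []       x = ∈-subsets x
  full∈stack (D ∷ Ds) x = high⁺ {K = pad ⊤ D} (full∈stack Ds x)

  -- A union with a member of the padded `D` has all later markers, and the power set at the end of
  -- the stack admits every string that has them all.
  full-absorbed : ∀ (D : List (Subset n)) (Ds : List (List (Subset n))) →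
                  Absorbed (pad (⊤ {length Ds}) D) (stack Ds)
  full-absorbed D Ds _ g x∈ _
    with x , _ , refl ← ∈-map⁻ (⊤ Vec.++_) x∈ | s , y , refl ← Vec.splitAt (length Ds) g =
    subst (_∈ˡ stack Ds) (sym (trans (++-⊔ ⊤ s x y) (cong (Vec._++ (x ⊔ y)) (⊔-zeroˡ s))))
      (full∈stack Ds (x ⊔ y))

  stack-closed : ∀ {Ds : List (List (Subset n))} → All Closed Ds → Closed (stack Ds)
  stack-closed []                                 _ _ _ _ = ∈-subsets _
  stack-closed {Ds = D ∷ Ds} (D-closed ∷ Ds-closed) =
    layers-closed (pad-absorbed (⊔-idem ⊤) D-closed) (stack-closed Ds-closed) (full-absorbed D Ds)

  -- Members of `E` carry no marker, so joining one keeps a set over its own `D`. It therefore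
  -- suffices that each `D` absorbs `E`.
  stack-absorbs : ∀ {E} {Ds : List (List (Subset n))} → All (Absorbed E) Ds →
                  Absorbed (pad (⊥ {length Ds}) E) (stack Ds)
  stack-absorbs [] _ _ _ _ = ∈-subsets _
  stack-absorbs {E} {D ∷ Ds} (E≤D ∷ E≤Ds) _ (b ∷ g) x∈ y∈
    with e , e∈ , refl ← ∈-map⁻ (⊥ Vec.++_) x∈ with layers⁻ {K = pad ⊤ D} y∈
  ... | inj₁ (refl , g∈) = low⁺ (pad-absorbed (⊔-identityˡ ⊤) E≤D _ _ (∈-map⁺ (⊥ Vec.++_) e∈) g∈)
  ... | inj₂ (refl , g∈) = high⁺ {K = pad ⊤ D} (stack-absorbs E≤Ds _ g (∈-map⁺ (⊥ Vec.++_) e∈) g∈)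

  stack-unique : ∀ {Ds : List (List (Subset n))} → All Uniqueˡ Ds → Uniqueˡ (stack Ds)
  stack-unique []         = subsets-unique n
  stack-unique (D! ∷ Ds!) = layers-unique (pad-unique ⊤ D!) (stack-unique Ds!)

  -- The leading element, absent from the copy of `E` alone, keeps that copy disjoint from the
  -- stack. All further bits added to `E` are zero, so its members remain the same sets of naturals.
  tower : List (Subset n) → (Ds : List (List (Subset n))) → List (Subset (suc (length Ds) + n))
  tower E Ds = layers (pad (⊥ {length Ds}) E) (stack Ds)

  tower-unique : ∀ {E Ds} → Uniqueˡ E → All Uniqueˡ Ds → Uniqueˡ (tower E Ds)
  tower-unique E! Ds! = layers-unique (pad-unique ⊥ E!) (stack-unique Ds!)

  tower-closed : ∀ {E Ds} → Closed E → All Closed Ds → All (Absorbed E) Ds → Closed (tower E Ds)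
  tower-closed E-closed Ds-closed E≤Ds =
    layers-closed (pad-absorbed (⊔-idem ⊥) E-closed) (stack-closed Ds-closed) (stack-absorbs E≤Ds)

-- Families avoiding one element, and their multiplicities.

-- For union-closed E, the smallest family containing all sets without i and
-- absorbing E.

module Avoiding {n : ℕ} (i : ℕ) (E : List (Subset n)) where

  -- `e ⊔ u ≡ u` says that e is inside u; such a u is the union of e and of u without i. For i in
  -- [n] the sets avoiding i are balanced in every other element and count against i. The sets of
  -- the second kind form an up-set, which can only favour the other elements. So each such family
  -- lowers i at some cost to the rest, and the multiplicities trade these costs off.
  Member : Subset n → Set
  Member u = bit i u ≡ false ⊎ Any (λ e → bit i e ≡ true × e ⊔ u ≡ u) E

  member? : ∀ u → Dec (Member u)
  member? u = (bit i u Bool.≟ false) ⊎-dec any? (λ e → (bit i e Bool.≟ true) ×-dec ((e ⊔ u) ≟ˢ u)) E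

  family : List (Subset n)
  family = filter member? (subsets n)

  unique : Uniqueˡ family
  unique = Unique.filter⁺ member? (subsets-unique n)

  private
    bit-⊔ : ∀ {n} (u v : Subset n) → bit i (u ⊔ v) ≡ bit i u ∨ bit i v
    bit-⊔ {zero}  []      []      = refl
    bit-⊔ {suc n} (a ∷ u) (b ∷ v) with i ≡ᵇ suc n
    ... | true  = refl
    ... | false = bit-⊔ u v

    ⊔-below : ∀ {e u : Subset n} v → e ⊔ u ≡ u → e ⊔ (u ⊔ v) ≡ u ⊔ v
    ⊔-below {e} {u} v e⊔u≡u = trans (sym (⊔-assoc e u v)) (cong (_⊔ v) e⊔u≡u)

    member-⊔ : ∀ {u v} → Member u → Member v → Member (u ⊔ v)
    member-⊔ {u} {v} (inj₁ i∉u) (inj₁ i∉v) = inj₁ (trans (bit-⊔ u v) (cong₂ _∨_ i∉u i∉v))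
    member-⊔ {u} {v} (inj₂ e)   _          = inj₂ (Any.map (λ (i∈e , e≤u) → i∈e , ⊔-below v e≤u) e)
    member-⊔ {u} {v} (inj₁ _)   (inj₂ e)   =
      subst Member (⊔-comm v u) (inj₂ (Any.map (λ (i∈e , e≤v) → i∈e , ⊔-below u e≤v) e))

    member-E : ∀ {e} → e ∈ˡ E → Member e
    member-E {e} e∈ with bit i e in eq
    ... | false = inj₁ refl
    ... | true  = inj₂ (lose e∈ (eq , ⊔-idem e))

    family⁺ : ∀ {u} → Member u → u ∈ˡ family
    family⁺ = ∈-filter⁺ member? (∈-subsets _)

    family⁻ : ∀ {u} → u ∈ˡ family → Member u
    family⁻ u∈ = proj₂ (∈-filter⁻ member? {xs = subsets n} u∈)

  closed : Closed family
  closed u v u∈ v∈ = family⁺ (member-⊔ (family⁻ u∈) (family⁻ v∈))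

  absorbed : Absorbed E family
  absorbed e v e∈ v∈ = family⁺ (member-⊔ (member-E e∈) (family⁻ v∈))

-- The lexicographically last k of the 2 ^ n bit strings, for 1 ≤ k ≤ 2 ^ n; a
-- union-closed family of prescribed size.

final : ∀ n → ℕ → List (Subset n)
final zero    k = [] ∷ []
final (suc n) k =
  if k ≤ᵇ 2 ^ n then layers [] (final n k) else layers (final n (k ∸ 2 ^ n)) (subsets n)

final-unique : ∀ n k → Uniqueˡ (final n k)
final-unique zero    k = [] ∷ []
final-unique (suc n) k with k ≤ᵇ 2 ^ n
... | true  = layers-unique [] (final-unique n k)
... | false = layers-unique (final-unique n (k ∸ 2 ^ n)) (subsets-unique n)

final-closed : ∀ n k → Closed (final n k)
final-closed zero    k []      []      _ _ = here refl
final-closed (suc n) k with k ≤ᵇ 2 ^ n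
... | true  = layers-closed (λ _ _ ()) (final-closed n k) (λ _ _ ())
... | false = layers-closed (final-closed n (k ∸ 2 ^ n))
  (λ _ _ _ _ → ∈-subsets _) (λ _ _ _ _ → ∈-subsets _)

⊥-absorbed : ∀ {m n} {L : List (Subset m)} {E D : List (Subset n)} →
             Absorbed E D → Absorbed (pad ⊥ E) (L ⊠ D)
⊥-absorbed {L = L} {D = D} E≤D _ _ x∈ y∈
  with e , e∈ , refl ← ∈-map⁻ (⊥ Vec.++_) x∈
     | t , d , t∈ , d∈ , refl ← ∈-cartesianProductWith⁻ Vec._++_ L D y∈ =
  subst (_∈ˡ L ⊠ D) (sym (trans (++-⊔ ⊥ t e d) (cong (Vec._++ (e ⊔ d)) (⊔-identityˡ t))))
    (∈-cartesianProductWith⁺ Vec._++_ t∈ (E≤D e d e∈ d∈))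

-- Margins of single elements under the constructions.

excess : ∀ {n} → ℕ → List (Subset n) → ℤ
excess i = sumOver (sign ∘ bit i)

bit-head : ∀ {n} b (u : Subset n) → bit (suc n) (b ∷ u) ≡ b
bit-head {n} b u rewrite dec-true (n ℕ.≟ n) refl = refl

module _ {i n : ℕ} (i<n : i < n) where

  bit-tail : ∀ b (u : Subset n) → bit (suc i) (b ∷ u) ≡ bit (suc i) u
  bit-tail b u rewrite dec-false (i ℕ.≟ n) (ℕ.<⇒≢ i<n) = refl

  excess-layers : (K L : List (Subset n)) →
                  excess (suc i) (layers K L) ≡ excess (suc i) K ℤ.+ excess (suc i) L
  excess-layers K L = trans (sumOver-++ (sign ∘ bit (suc i)) (map (false ∷_) K) (map (true ∷_) L))
    (cong₂ ℤ._+_ (layer false K) (layer true L))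
    where
    layer : ∀ b M → excess (suc i) (map (b ∷_) M) ≡ excess (suc i) M
    layer b M = trans (sumOver-map (sign ∘ bit (suc i)) (b ∷_) M)
      (sumOver-cong (λ u → cong sign (bit-tail b u)) M)

-- For the largest element the two layers cancel; for a smaller one each layer vanishes by
-- induction. Hence the power set ending a stack costs nothing.
excess-subsets : ∀ {i n} → i < n → excess (suc i) (subsets n) ≡ 0ℤ
excess-subsets {i} {suc n} (s≤s i≤n) with ℕ.m≤n⇒m<n∨m≡n i≤n
... | inj₁ i<n  = trans (excess-layers i<n (subsets n) (subsets n))
  (cong₂ ℤ._+_ (excess-subsets i<n) (excess-subsets i<n))
... | inj₂ refl = begin
  excess (suc n) (layers (subsets n) (subsets n))
    ≡⟨ sumOver-++ (sign ∘ bit (suc n)) (map (false ∷_) (subsets n)) (map (true ∷_) (subsets n)) ⟩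
  excess (suc n) (map (false ∷_) (subsets n)) ℤ.+ excess (suc n) (map (true ∷_) (subsets n))
    ≡⟨ cong₂ ℤ._+_ (layer false) (layer true) ⟩
  sumOver (λ _ → -1ℤ) (subsets n) ℤ.+ sumOver (λ _ → 1ℤ) (subsets n)
    ≡⟨ sumOver-+ (λ _ → -1ℤ) (λ _ → 1ℤ) (subsets n) ⟨
  sumOver (λ _ → 0ℤ) (subsets n)
    ≡⟨ sumOver-0 (subsets n) ⟩
  0ℤ ∎
  where
  open ≡-Reasoning
  layer : ∀ b → excess (suc n) (map (b ∷_) (subsets n)) ≡ sumOver (λ _ → sign b) (subsets n)
  layer b = trans (sumOver-map (sign ∘ bit (suc n)) (b ∷_) (subsets n))
    (sumOver-cong (λ u → cong sign (bit-head b u)) (subsets n))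

module _ {i n : ℕ} (i<n : i < n) where

  bit-++ : ∀ {m} (s : Subset m) (u : Subset n) → bit (suc i) (s Vec.++ u) ≡ bit (suc i) u
  bit-++         []      u = refl
  bit-++ {suc m} (b ∷ s) u =
    trans (bit-tail (ℕ.≤-trans i<n (ℕ.m≤n+m n m)) b (s Vec.++ u)) (bit-++ s u)

  excess-pad : ∀ {m} (s : Subset m) (D : List (Subset n)) → excess (suc i) (pad s D) ≡ excess (suc i) D
  excess-pad s D = trans (sumOver-map (sign ∘ bit (suc i)) (s Vec.++_) D)
    (sumOver-cong (λ u → cong sign (bit-++ s u)) D)

  excess-⊠ : ∀ {m} (K : List (Subset m)) (D : List (Subset n)) →
             excess (suc i) (K ⊠ D) ≡ + length K ℤ.* excess (suc i) D
  excess-⊠ []      D = sym (ℤ.*-zeroˡ (excess (suc i) D))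
  excess-⊠ (s ∷ K) D = begin
    excess (suc i) (pad s D ++ K ⊠ D)
      ≡⟨ sumOver-++ (sign ∘ bit (suc i)) (pad s D) (K ⊠ D) ⟩
    excess (suc i) (pad s D) ℤ.+ excess (suc i) (K ⊠ D)
      ≡⟨ cong₂ ℤ._+_ (excess-pad s D) (excess-⊠ K D) ⟩
    excess (suc i) D ℤ.+ + length K ℤ.* excess (suc i) D
      ≡⟨ ℤ.suc-* (+ length K) (excess (suc i) D) ⟨
    + suc (length K) ℤ.* excess (suc i) D ∎
    where open ≡-Reasoning

  excess-stack : ∀ (Ds : List (List (Subset n))) →
                 excess (suc i) (stack Ds) ≡ sumOver (excess (suc i)) Ds
  excess-stack []       = excess-subsets i<n
  excess-stack (D ∷ Ds) =
    trans (excess-layers (ℕ.≤-trans i<n (ℕ.m≤n+m n (length Ds))) (pad (⊤ {length Ds}) D) (stack Ds))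
          (cong₂ ℤ._+_ (excess-pad (⊤ {length Ds}) D) (excess-stack Ds))

  excess-tower : ∀ (E : List (Subset n)) (Ds : List (List (Subset n))) →
                 excess (suc i) (tower E Ds) ≡ sumOver (excess (suc i)) (E ∷ Ds)
  excess-tower E Ds =
    trans (excess-layers (ℕ.≤-trans i<n (ℕ.m≤n+m n (length Ds))) (pad (⊥ {length Ds}) E) (stack Ds))
          (cong₂ ℤ._+_ (excess-pad (⊥ {length Ds}) E) (excess-stack Ds))

rare : ∀ {n} i (L : List (Subset n)) → excess i L ℤ.< 0ℤ →
       2 * length (map setOf L at i) < length (map setOf L)
rare i L excess<0 = ℕ.≰⇒> λ few≤ → ℤ.<⇒≱ neg (ℤ.i≤j⇒0≤j-i (ℤ.+≤+ few≤))
  where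
  open ℤ.≤-Reasoning
  F : Family
  F = map setOf L

  neg : + (2 * length (F at i)) ℤ.- + length F ℤ.< 0ℤ
  neg = begin-strict
    + (2 * length (F at i)) ℤ.- + length F         ≡⟨ cong (ℤ._- + length F) (ℤ.pos-* 2 (length (F at i))) ⟩
    + 2 ℤ.* + length (F at i) ℤ.- + length F       ≡⟨ sumOver-sign i F ⟨
    sumOver (λ A → sign (does (i ∈? A))) F         ≡⟨ sumOver-map (λ A → sign (does (i ∈? A))) setOf L ⟩
    sumOver (λ u → sign (does (i ∈? setOf u))) L   ≡⟨ sumOver-cong (λ u → cong sign (bit-setOf i u)) L ⟩
    excess i L                                     <⟨ excess<0 ⟩
    0ℤ                                             ∎


-- Assembling the Non-FC witness.

setOf-pad : ∀ m {n} (u : Subset n) → setOf (⊥ {m} Vec.++ u) ≡ setOf u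
setOf-pad zero    u = refl
setOf-pad (suc m) u = setOf-pad m u

-- An entry (i , k) stands for k copies of the family avoiding i.

module Witness {n : ℕ} (E : List (Subset n)) (m : ℕ) (multiplicities : List (ℕ × ℕ)) where

  -- All blocks reuse the same `m` new elements, since the markers already separate them. So `2 ^ m`
  -- only has to reach the largest multiplicity: 59 with `m` equal to 6 below.
  block : ℕ × ℕ → List (Subset (m + n))
  block (i , k) = final m k ⊠ Avoiding.family i E

  blocks : List (List (Subset (m + n)))
  blocks = map block multiplicities

  family : List (Subset (suc (length blocks) + (m + n)))
  family = tower (pad (⊥ {m}) E) blocks

  unique : Uniqueˡ E → Uniqueˡ family
  unique E! = tower-unique (pad-unique (⊥ {m}) E!) (All.map⁺ (All.universal
    (λ (i , k) → ⊠-unique (final-unique m k) (Avoiding.unique i E)) multiplicities))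

  closed : Closed E → Closed family
  closed E-closed = tower-closed
    (pad-absorbed (⊔-idem (⊥ {m})) E-closed)
    (All.map⁺ (All.universal
      (λ (i , k) → ⊠-absorbed {K = final m k} (final-closed m k) (Avoiding.closed i E)) multiplicities))
    (All.map⁺ (All.universal
      (λ (i , k) → ⊥-absorbed {L = final m k} {E} (Avoiding.absorbed i E)) multiplicities))

  contains : ∀ {u} → u ∈ˡ E → setOf u ∈ˡ map setOf family
  contains {u} u∈ = subst (_∈ˡ map setOf family)
    (trans (setOf-pad (length blocks) (⊥ {m} Vec.++ u)) (setOf-pad m u))
    (∈-map⁺ setOf (low⁺ (∈-map⁺ (⊥ {length blocks} Vec.++_) (∈-map⁺ (⊥ {m} Vec.++_) u∈))))

  -- `length (final m k)` evaluates to `k` for the multiplicities in use, so the margins are settled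
  -- by computation.
  blockExcess : ℕ → ℕ × ℕ → ℤ
  blockExcess i (j , k) = + length (final m k) ℤ.* excess i (Avoiding.family j E)

  totalExcess : ℕ → ℤ
  totalExcess i = excess i E ℤ.+ sumOver (blockExcess i) multiplicities

  excess-family : ∀ {i} → i < n → excess (suc i) family ≡ totalExcess (suc i)
  excess-family i<n = trans
    (excess-tower (ℕ.≤-trans i<n (ℕ.m≤n+m n m)) (pad (⊥ {m}) E) blocks)
    (cong₂ ℤ._+_ (excess-pad i<n (⊥ {m}) E)
      (trans (sumOver-map (excess _) block multiplicities)
        (sumOver-cong (λ (j , k) → excess-⊠ i<n (final m k) (Avoiding.family j E)) multiplicities)))

  -- Every remaining condition concerns subsets of [n] only: additivity of the excess replaces the
  -- count over the whole witness by `totalExcess`.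
  nonFC : ∀ {A} → UC A → A ⊆ᶠ map setOf E → All (_∈ [1⋯ n ]) (U A) → ∃[ u ] u ∈ˡ E → Uniqueˡ E →
          Closed E → All (λ i → totalExcess i ℤ.< 0ℤ) [1⋯ n ] → NonFC A
  nonFC A-uc A⊆E A≤n (u , u∈) E! E-closed negative =
    A-uc , map setOf family , setOf-uc family-∋ (unique E!) (closed E-closed) ,
    (λ B∈A → let C , C∈ , B≋C = find (A⊆E B∈A)
                 v , v∈ , C≡  = ∈-map⁻ setOf C∈
             in ∈ᶠ-resp (≋.sym B≋C) (lose (subst (_∈ˡ map setOf family) (sym C≡) (contains v∈)) ≋.refl)) ,
    λ i i∈ → few i (All.lookup A≤n i∈)
    where
    family-∋ : false ∷ (⊥ {length blocks} Vec.++ (⊥ {m} Vec.++ u)) ∈ˡ family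
    family-∋ = low⁺ (∈-map⁺ (⊥ {length blocks} Vec.++_) (∈-map⁺ (⊥ {m} Vec.++_) u∈))

    few : ∀ i → i ∈ [1⋯ n ] → 2 * length (map setOf family at i) < length (map setOf family)
    few i i∈ with j , j<n , refl ← ∈-applyUpTo⁻ suc i∈ =
      rare (suc j) family (subst (ℤ._< 0ℤ) (sym (excess-family j<n)) (All.lookup negative i∈))

-- The family `S` and the Non-FC property of `⟨S⟩`.

S : Family
S = ∅ ∷ (4 ∷ 5 ∷ 6 ∷ []) ∷ (1 ∷ 3 ∷ 4 ∷ []) ∷ (1 ∷ 2 ∷ 5 ∷ 6 ∷ []) ∷ (1 ∷ 2 ∷ 3 ∷ 4 ∷ []) ∷ []

-- The three added sets are the only unions of members of `S` that are not in `S`.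
⟨S⟩ : Family
⟨S⟩ = (1 ∷ 3 ∷ 4 ∷ 5 ∷ 6 ∷ []) ∷ (1 ∷ 2 ∷ 4 ∷ 5 ∷ 6 ∷ []) ∷ [1⋯ 6 ] ∷ S

S-generates : S GeneratorOf ⟨S⟩
S-generates = generates S (toWitness {a? = generates? S ⟨S⟩} tt)

S-minimal : S MinimalGeneratorOf ⟨S⟩
S-minimal = minimal S-generates (toWitness {a? = all? (λ A → uc? (⟨S⟩ ∖ A)) S} tt)

nonFC-⟨S⟩ : NonFC ⟨S⟩
nonFC-⟨S⟩ = nonFC (_GeneratorOf_.uc S-generates)
  (λ B∈ → let C , C∈ , B≋C = find B∈ in ∈ᶠ-resp (≋.sym B≋C) (All.lookup covered C∈))
  (toWitness {a? = all? (_∈? [1⋯ 6 ]) (U ⟨S⟩)} tt) (_ , here refl)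
  (toWitness {a? = unique? traces} tt) (toWitness {a? = absorbed? traces traces} tt)
  (toWitness {a? = all? (λ i → totalExcess i ℤ.<? 0ℤ) [1⋯ 6 ]} tt)
  where
  traces : List (Subset 6)
  traces = map (trace 6) ⟨S⟩

  -- An integer point near the solution of the linear program for the margins.
  open Witness traces 6 ((1 , 40) ∷ (2 , 12) ∷ (3 , 28) ∷ (4 , 59) ∷ (5 , 43) ∷ (6 , 43) ∷ [])

  covered : All (_∈ᶠ map setOf traces) ⟨S⟩
  covered = toWitness {a? = all? (_∈ᶠ? map setOf traces) ⟨S⟩} tt

-- Failure of regularity.

A : FinSet
A = 1 ∷ 2 ∷ 3 ∷ 4 ∷ []

-- `S′` is spelled as in `Regular`, so `S′-generates` has literally the type of the premise to be
-- supplied there.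
S′ ⟨S′⟩ : Family
S′   = (A ∪ ⁅ 5 ⁆) ∷ S ∖ A
⟨S′⟩ = (1 ∷ 3 ∷ 4 ∷ 5 ∷ 6 ∷ []) ∷ (1 ∷ 2 ∷ 4 ∷ 5 ∷ 6 ∷ []) ∷ [1⋯ 6 ] ∷ S′

S′-generates : S′ GeneratorOf ⟨S′⟩
S′-generates = generates S′ (toWitness {a? = generates? S′ ⟨S′⟩} tt)

-- For the elements 6, …, 1 in this order.  Weights and certificate were found by
-- linear programming and branch and bound.

weights : Vec ℕ 6
weights = 15 ∷ 17 ∷ 20 ∷ 12 ∷ 8 ∷ 16 ∷ []

certificate : Certificate
certificate =
  (branch 32
   (branch 1
    (branch 8
     (branch 4
      (branch 2
       -- The middle entries 56, 13, 51 and 31 are the generators {4,5,6}, {1,3,4}, {1,2,5,6} and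
       -- {1,2,3,4,5}. Any other middle entry is a set placed in `b` on the path to the leaf, here
       -- the singletons 32, 1, 8, 4 and 2. The last leaf of the tree, with every decided set
       -- outside `b`, uses the generators alone.
       (flow ((1 , 13 , 32) ∷ (13 , 2 , 24) ∷ (1 , 31 , 58) ∷ (32 , 1 , 58) ∷ (33 , 4 , 14) ∷
         (37 , 2 , 14) ∷ (33 , 8 , 44) ∷ (41 , 2 , 30) ∷ (32 , 8 , 28) ∷ (40 , 4 , 28) ∷
         (32 , 13 , 92) ∷ (44 , 2 , 22) ∷ (45 , 2 , 54) ∷ (32 , 51 , 72) ∷ (51 , 4 , 48) ∷
         (32 , 56 , 328) ∷ (56 , 1 , 48) ∷ (56 , 2 , 32) ∷ (56 , 51 , 64) ∷ (56 , 4 , 96) ∷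
         (56 , 13 , 72) ∷ (60 , 2 , 56) ∷ (32 , 31 , 88) ∷ (16 , 13 , 42) ∷ (16 , 1 , 10) ∷
         (16 , 8 , 2) ∷ (17 , 32 , 8) ∷ (17 , 8 , 14) ∷ (17 , 4 , 10) ∷ (18 , 8 , 2) ∷
         (18 , 1 , 36) ∷ (19 , 8 , 34) ∷ (19 , 4 , 8) ∷ (20 , 1 , 2) ∷ (20 , 8 , 10) ∷
         (20 , 32 , 18) ∷ (21 , 2 , 10) ∷ (22 , 8 , 14) ∷ (24 , 1 , 4) ∷ (24 , 4 , 12) ∷
         (28 , 2 , 12) ∷ (48 , 1 , 14) ∷ (48 , 4 , 8) ∷ (49 , 4 , 14) ∷ (50 , 4 , 8) ∷
         (52 , 1 , 18) ∷ (52 , 2 , 8) ∷ []))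
       (flow ((1 , 13 , 8) ∷ (1 , 31 , 58) ∷ (32 , 1 , 14) ∷ (33 , 8 , 14) ∷ (32 , 8 , 6) ∷
         (40 , 4 , 6) ∷ (32 , 13 , 38) ∷ (32 , 51 , 72) ∷ (51 , 4 , 48) ∷ (32 , 56 , 240) ∷
         (56 , 1 , 48) ∷ (56 , 51 , 64) ∷ (56 , 4 , 40) ∷ (56 , 13 , 72) ∷ (32 , 31 , 88) ∷
         (3 , 13 , 24) ∷ (3 , 32 , 16) ∷ (6 , 56 , 48) ∷ (7 , 32 , 14) ∷ (7 , 13 , 2) ∷
         (10 , 56 , 32) ∷ (14 , 56 , 8) ∷ (15 , 32 , 2) ∷ (16 , 13 , 42) ∷ (17 , 32 , 8) ∷
         (17 , 8 , 14) ∷ (18 , 8 , 2) ∷ (18 , 1 , 36) ∷ (19 , 8 , 34) ∷ (19 , 4 , 8) ∷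
         (20 , 1 , 2) ∷ (20 , 8 , 10) ∷ (20 , 32 , 18) ∷ (22 , 32 , 8) ∷ (22 , 1 , 6) ∷
         (24 , 1 , 4) ∷ (34 , 13 , 42) ∷ (35 , 13 , 8) ∷ (35 , 8 , 18) ∷ (38 , 13 , 2) ∷
         (38 , 8 , 16) ∷ (42 , 1 , 2) ∷ (48 , 1 , 14) ∷ (49 , 4 , 14) ∷ (50 , 4 , 8) ∷
         (52 , 1 , 18) ∷ [])))
      (flow ((1 , 13 , 8) ∷ (1 , 31 , 58) ∷ (32 , 1 , 14) ∷ (33 , 8 , 14) ∷ (32 , 13 , 38) ∷
        (32 , 51 , 24) ∷ (32 , 56 , 200) ∷ (56 , 1 , 48) ∷ (56 , 51 , 64) ∷ (56 , 13 , 72) ∷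
        (32 , 31 , 88) ∷ (2 , 56 , 32) ∷ (2 , 13 , 26) ∷ (3 , 32 , 28) ∷ (5 , 51 , 32) ∷
        (6 , 56 , 48) ∷ (7 , 51 , 2) ∷ (7 , 32 , 14) ∷ (12 , 56 , 24) ∷ (14 , 56 , 8) ∷
        (15 , 32 , 2) ∷ (16 , 13 , 42) ∷ (17 , 32 , 8) ∷ (17 , 8 , 14) ∷ (18 , 8 , 2) ∷
        (18 , 1 , 28) ∷ (19 , 8 , 34) ∷ (20 , 1 , 2) ∷ (20 , 8 , 10) ∷ (20 , 32 , 18) ∷
        (22 , 32 , 14) ∷ (24 , 1 , 4) ∷ (34 , 13 , 42) ∷ (35 , 13 , 10) ∷ (35 , 8 , 28) ∷
        (36 , 8 , 6) ∷ (36 , 56 , 16) ∷ (36 , 51 , 12) ∷ (37 , 51 , 2) ∷ (38 , 8 , 18) ∷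
        (42 , 1 , 2) ∷ (52 , 1 , 18) ∷ [])))
     (branch 18
      (branch 4
       (flow ((1 , 13 , 8) ∷ (1 , 18 , 18) ∷ (19 , 4 , 18) ∷ (1 , 31 , 58) ∷ (32 , 13 , 38) ∷
         (32 , 51 , 72) ∷ (32 , 18 , 16) ∷ (50 , 4 , 16) ∷ (51 , 4 , 48) ∷ (32 , 56 , 328) ∷
         (56 , 1 , 48) ∷ (56 , 18 , 88) ∷ (56 , 51 , 64) ∷ (56 , 4 , 40) ∷ (56 , 13 , 72) ∷
         (58 , 4 , 56) ∷ (32 , 31 , 88) ∷ (2 , 13 , 24) ∷ (7 , 32 , 14) ∷ (9 , 18 , 16) ∷
         (10 , 18 , 2) ∷ (10 , 32 , 30) ∷ (12 , 32 , 2) ∷ (12 , 18 , 22) ∷ (14 , 32 , 8) ∷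
         (16 , 13 , 42) ∷ (17 , 32 , 20) ∷ (17 , 4 , 2) ∷ (20 , 32 , 20) ∷ (24 , 1 , 14) ∷
         (34 , 13 , 42) ∷ (35 , 13 , 10) ∷ (38 , 13 , 2) ∷ (40 , 1 , 14) ∷ (40 , 4 , 4) ∷
         (42 , 1 , 30) ∷ (42 , 4 , 2) ∷ (49 , 4 , 12) ∷ (52 , 1 , 20) ∷ []))
       (flow ((1 , 13 , 8) ∷ (1 , 31 , 58) ∷ (32 , 13 , 38) ∷ (32 , 51 , 24) ∷ (32 , 56 , 232) ∷
         (56 , 1 , 48) ∷ (56 , 18 , 32) ∷ (56 , 51 , 64) ∷ (56 , 13 , 72) ∷ (32 , 31 , 88) ∷
         (2 , 13 , 26) ∷ (5 , 51 , 22) ∷ (5 , 18 , 10) ∷ (6 , 56 , 48) ∷ (7 , 51 , 16) ∷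
         (9 , 18 , 16) ∷ (10 , 18 , 2) ∷ (10 , 32 , 28) ∷ (10 , 1 , 2) ∷ (11 , 18 , 2) ∷
         (12 , 32 , 6) ∷ (12 , 18 , 18) ∷ (14 , 56 , 4) ∷ (14 , 32 , 4) ∷ (15 , 32 , 2) ∷
         (16 , 13 , 42) ∷ (17 , 32 , 8) ∷ (20 , 56 , 16) ∷ (20 , 1 , 2) ∷ (20 , 32 , 12) ∷
         (22 , 32 , 14) ∷ (24 , 1 , 14) ∷ (34 , 13 , 42) ∷ (35 , 13 , 10) ∷ (36 , 18 , 2) ∷
         (36 , 56 , 24) ∷ (36 , 51 , 8) ∷ (37 , 51 , 2) ∷ (38 , 1 , 14) ∷ (38 , 56 , 4) ∷
         (40 , 1 , 14) ∷ (42 , 1 , 30) ∷ (52 , 1 , 12) ∷ [])))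
      (branch 2
       (flow ((1 , 13 , 32) ∷ (13 , 2 , 24) ∷ (1 , 31 , 58) ∷ (32 , 13 , 92) ∷ (45 , 2 , 54) ∷
         (32 , 51 , 24) ∷ (32 , 56 , 232) ∷ (56 , 1 , 48) ∷ (56 , 2 , 32) ∷ (56 , 51 , 64) ∷
         (56 , 13 , 72) ∷ (32 , 31 , 88) ∷ (16 , 2 , 54) ∷ (4 , 56 , 40) ∷ (4 , 51 , 24) ∷
         (5 , 51 , 24) ∷ (6 , 56 , 48) ∷ (7 , 32 , 14) ∷ (9 , 32 , 16) ∷ (10 , 32 , 26) ∷
         (12 , 32 , 24) ∷ (14 , 56 , 4) ∷ (14 , 32 , 4) ∷ (17 , 13 , 22) ∷ (20 , 13 , 20) ∷
         (20 , 1 , 2) ∷ (20 , 32 , 8) ∷ (22 , 32 , 14) ∷ (24 , 1 , 14) ∷ (38 , 56 , 4) ∷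
         (41 , 2 , 2) ∷ (42 , 1 , 28) ∷ (44 , 2 , 18) ∷ (48 , 1 , 8) ∷ (52 , 1 , 8) ∷ []))
       (flow ((1 , 13 , 8) ∷ (1 , 31 , 58) ∷ (32 , 13 , 38) ∷ (32 , 51 , 24) ∷ (32 , 56 , 200) ∷
         (56 , 1 , 48) ∷ (56 , 51 , 64) ∷ (56 , 13 , 72) ∷ (32 , 31 , 88) ∷ (3 , 13 , 36) ∷
         (4 , 56 , 40) ∷ (4 , 51 , 24) ∷ (5 , 51 , 24) ∷ (6 , 56 , 48) ∷ (7 , 32 , 14) ∷
         (9 , 32 , 14) ∷ (10 , 56 , 4) ∷ (10 , 32 , 28) ∷ (12 , 32 , 6) ∷ (14 , 32 , 8) ∷
         (15 , 32 , 12) ∷ (16 , 13 , 42) ∷ (17 , 32 , 8) ∷ (20 , 1 , 2) ∷ (20 , 32 , 28) ∷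
         (22 , 32 , 14) ∷ (24 , 1 , 14) ∷ (34 , 13 , 22) ∷ (34 , 56 , 20) ∷ (35 , 13 , 10) ∷
         (38 , 13 , 10) ∷ (38 , 56 , 8) ∷ (42 , 1 , 30) ∷ (50 , 56 , 8) ∷ (52 , 1 , 28) ∷ [])))))
    (branch 16
     (branch 8
      (branch 2
       (flow ((8 , 13 , 32) ∷ (13 , 2 , 24) ∷ (16 , 8 , 2) ∷ (24 , 2 , 2) ∷ (16 , 13 , 42) ∷
         (16 , 31 , 58) ∷ (32 , 13 , 92) ∷ (45 , 2 , 54) ∷ (32 , 51 , 24) ∷ (32 , 56 , 184) ∷
         (56 , 2 , 32) ∷ (56 , 51 , 64) ∷ (56 , 13 , 72) ∷ (32 , 31 , 88) ∷ (3 , 32 , 20) ∷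
         (3 , 16 , 20) ∷ (4 , 56 , 40) ∷ (4 , 51 , 24) ∷ (5 , 16 , 2) ∷ (5 , 32 , 30) ∷
         (6 , 56 , 48) ∷ (7 , 32 , 14) ∷ (7 , 16 , 2) ∷ (9 , 56 , 16) ∷ (12 , 32 , 12) ∷
         (12 , 16 , 12) ∷ (14 , 56 , 8) ∷ (17 , 56 , 22) ∷ (19 , 8 , 26) ∷ (20 , 8 , 24) ∷
         (20 , 51 , 6) ∷ (22 , 32 , 14) ∷ (28 , 2 , 26) ∷ (33 , 56 , 10) ∷ (33 , 16 , 8) ∷
         (33 , 8 , 8) ∷ (35 , 8 , 30) ∷ (36 , 51 , 18) ∷ (37 , 16 , 32) ∷ (38 , 16 , 2) ∷
         (38 , 8 , 16) ∷ (44 , 2 , 6) ∷ []))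
       (flow ((8 , 13 , 8) ∷ (16 , 13 , 42) ∷ (16 , 31 , 58) ∷ (32 , 13 , 38) ∷ (32 , 51 , 24) ∷
         (32 , 56 , 152) ∷ (56 , 51 , 64) ∷ (56 , 13 , 72) ∷ (32 , 31 , 88) ∷ (3 , 13 , 2) ∷
         (3 , 32 , 20) ∷ (3 , 16 , 18) ∷ (4 , 56 , 40) ∷ (4 , 51 , 24) ∷ (5 , 16 , 2) ∷
         (5 , 32 , 30) ∷ (6 , 56 , 48) ∷ (7 , 32 , 14) ∷ (7 , 16 , 2) ∷ (9 , 56 , 16) ∷
         (10 , 13 , 32) ∷ (12 , 32 , 6) ∷ (12 , 16 , 10) ∷ (14 , 56 , 8) ∷ (15 , 32 , 10) ∷
         (17 , 56 , 22) ∷ (18 , 8 , 2) ∷ (18 , 56 , 32) ∷ (19 , 8 , 24) ∷ (20 , 51 , 24) ∷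
         (22 , 32 , 14) ∷ (33 , 56 , 10) ∷ (33 , 16 , 8) ∷ (33 , 8 , 8) ∷ (34 , 13 , 42) ∷
         (35 , 8 , 30) ∷ (37 , 16 , 32) ∷ (38 , 16 , 2) ∷ (38 , 8 , 16) ∷ (42 , 13 , 2) ∷ [])))
      (branch 3
       (flow ((3 , 13 , 24) ∷ (16 , 13 , 42) ∷ (16 , 31 , 58) ∷ (32 , 13 , 92) ∷ (45 , 3 , 54) ∷
         (32 , 51 , 24) ∷ (32 , 56 , 152) ∷ (56 , 51 , 64) ∷ (56 , 13 , 72) ∷ (32 , 31 , 88) ∷
         (0 , 13 , 8) ∷ (2 , 56 , 32) ∷ (4 , 56 , 40) ∷ (4 , 51 , 24) ∷ (5 , 16 , 2) ∷
         (5 , 32 , 30) ∷ (6 , 56 , 48) ∷ (7 , 32 , 14) ∷ (7 , 16 , 2) ∷ (9 , 56 , 8) ∷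
         (9 , 32 , 8) ∷ (10 , 16 , 22) ∷ (10 , 32 , 10) ∷ (12 , 32 , 6) ∷ (12 , 16 , 10) ∷
         (14 , 32 , 8) ∷ (17 , 56 , 22) ∷ (20 , 3 , 16) ∷ (20 , 51 , 14) ∷ (22 , 32 , 14) ∷
         (24 , 3 , 14) ∷ (26 , 3 , 20) ∷ (33 , 56 , 18) ∷ (33 , 16 , 8) ∷ (36 , 51 , 10) ∷
         (37 , 16 , 32) ∷ (38 , 16 , 2) ∷ (38 , 56 , 8) ∷ (40 , 3 , 18) ∷ (42 , 3 , 12) ∷ []))
       (flow ((16 , 13 , 42) ∷ (16 , 31 , 58) ∷ (32 , 13 , 38) ∷ (32 , 51 , 24) ∷ (32 , 56 , 152) ∷
         (56 , 51 , 64) ∷ (56 , 13 , 72) ∷ (32 , 31 , 88) ∷ (0 , 13 , 8) ∷ (2 , 56 , 32) ∷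
         (2 , 13 , 24) ∷ (4 , 56 , 40) ∷ (4 , 51 , 24) ∷ (5 , 16 , 2) ∷ (5 , 32 , 30) ∷
         (6 , 56 , 48) ∷ (7 , 32 , 14) ∷ (7 , 16 , 2) ∷ (9 , 56 , 8) ∷ (9 , 32 , 8) ∷
         (10 , 16 , 2) ∷ (12 , 32 , 6) ∷ (12 , 16 , 10) ∷ (14 , 32 , 8) ∷ (17 , 56 , 22) ∷
         (20 , 51 , 24) ∷ (22 , 32 , 14) ∷ (33 , 56 , 18) ∷ (33 , 16 , 8) ∷ (34 , 13 , 42) ∷
         (35 , 13 , 10) ∷ (37 , 16 , 32) ∷ (38 , 13 , 2) ∷ (38 , 16 , 2) ∷ (38 , 56 , 8) ∷ []))))
     (branch 8
      (branch 18
       (flow ((8 , 13 , 8) ∷ (8 , 18 , 2) ∷ (8 , 31 , 58) ∷ (32 , 13 , 38) ∷ (32 , 51 , 24) ∷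
         (32 , 56 , 184) ∷ (56 , 18 , 32) ∷ (56 , 51 , 64) ∷ (56 , 13 , 72) ∷ (32 , 31 , 88) ∷
         (2 , 13 , 34) ∷ (3 , 32 , 20) ∷ (3 , 8 , 20) ∷ (4 , 56 , 40) ∷ (4 , 51 , 24) ∷
         (5 , 51 , 16) ∷ (5 , 18 , 16) ∷ (6 , 56 , 48) ∷ (7 , 32 , 14) ∷ (7 , 18 , 2) ∷
         (9 , 56 , 14) ∷ (9 , 18 , 2) ∷ (11 , 18 , 20) ∷ (12 , 18 , 24) ∷ (14 , 56 , 4) ∷
         (14 , 32 , 4) ∷ (15 , 32 , 10) ∷ (17 , 56 , 22) ∷ (19 , 8 , 6) ∷ (20 , 13 , 28) ∷
         (20 , 8 , 2) ∷ (22 , 32 , 12) ∷ (22 , 8 , 2) ∷ (24 , 13 , 14) ∷ (33 , 56 , 12) ∷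
         (33 , 8 , 14) ∷ (34 , 13 , 42) ∷ (35 , 8 , 30) ∷ (36 , 18 , 4) ∷ (36 , 51 , 8) ∷
         (36 , 8 , 6) ∷ (36 , 56 , 4) ∷ (38 , 8 , 18) ∷ (42 , 13 , 2) ∷ (60 , 18 , 4) ∷ []))
       (flow ((8 , 13 , 8) ∷ (8 , 31 , 58) ∷ (32 , 13 , 38) ∷ (32 , 51 , 24) ∷ (32 , 56 , 152) ∷
         (56 , 51 , 64) ∷ (56 , 13 , 72) ∷ (32 , 31 , 88) ∷ (2 , 56 , 32) ∷ (2 , 13 , 24) ∷
         (3 , 32 , 30) ∷ (4 , 56 , 40) ∷ (4 , 51 , 24) ∷ (5 , 51 , 24) ∷ (6 , 56 , 48) ∷
         (7 , 32 , 14) ∷ (9 , 56 , 16) ∷ (12 , 32 , 6) ∷ (14 , 56 , 8) ∷ (17 , 56 , 20) ∷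
         (17 , 32 , 2) ∷ (19 , 8 , 6) ∷ (20 , 13 , 28) ∷ (20 , 8 , 2) ∷ (22 , 32 , 14) ∷
         (24 , 13 , 14) ∷ (33 , 56 , 12) ∷ (33 , 8 , 14) ∷ (34 , 13 , 42) ∷ (35 , 13 , 10) ∷
         (35 , 8 , 30) ∷ (38 , 8 , 18) ∷ (42 , 13 , 2) ∷ [])))
      (branch 18
       (flow ((18 , 13 , 58) ∷ (32 , 13 , 38) ∷ (32 , 51 , 24) ∷ (32 , 56 , 184) ∷ (56 , 18 , 32) ∷
         (56 , 51 , 64) ∷ (56 , 13 , 72) ∷ (32 , 31 , 88) ∷ (0 , 13 , 8) ∷ (2 , 13 , 24) ∷
         (4 , 56 , 40) ∷ (4 , 51 , 24) ∷ (5 , 51 , 16) ∷ (5 , 18 , 16) ∷ (6 , 56 , 48) ∷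
         (7 , 32 , 14) ∷ (7 , 18 , 2) ∷ (9 , 32 , 14) ∷ (9 , 18 , 2) ∷ (10 , 18 , 2) ∷
         (12 , 32 , 6) ∷ (12 , 18 , 18) ∷ (14 , 32 , 8) ∷ (17 , 56 , 22) ∷ (20 , 13 , 30) ∷
         (22 , 32 , 14) ∷ (24 , 13 , 12) ∷ (33 , 56 , 26) ∷ (34 , 13 , 42) ∷ (35 , 13 , 10) ∷
         (36 , 18 , 2) ∷ (36 , 51 , 8) ∷ (38 , 13 , 2) ∷ (38 , 56 , 8) ∷ []))
       (flow ((32 , 13 , 38) ∷ (32 , 51 , 24) ∷ (32 , 56 , 152) ∷ (56 , 51 , 64) ∷ (56 , 13 , 72) ∷
         (32 , 31 , 88) ∷ (0 , 13 , 8) ∷ (0 , 31 , 58) ∷ (2 , 56 , 32) ∷ (2 , 13 , 24) ∷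
         (4 , 56 , 40) ∷ (4 , 51 , 24) ∷ (5 , 51 , 24) ∷ (6 , 56 , 48) ∷ (7 , 32 , 14) ∷
         (9 , 56 , 2) ∷ (9 , 32 , 14) ∷ (12 , 32 , 6) ∷ (14 , 32 , 8) ∷ (17 , 56 , 20) ∷
         (17 , 32 , 2) ∷ (20 , 13 , 30) ∷ (22 , 32 , 14) ∷ (24 , 13 , 12) ∷ (33 , 56 , 26) ∷
         (34 , 13 , 42) ∷ (35 , 13 , 10) ∷ (38 , 13 , 2) ∷ (38 , 56 , 8) ∷ []))))))
   (branch 16
    (branch 4
     (branch 3
      (branch 1
       (flow ((4 , 13 , 32) ∷ (13 , 3 , 24) ∷ (16 , 4 , 20) ∷ (20 , 1 , 2) ∷ (20 , 3 , 18) ∷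
         (16 , 13 , 42) ∷ (16 , 31 , 58) ∷ (16 , 51 , 72) ∷ (51 , 4 , 48) ∷ (16 , 56 , 328) ∷
         (56 , 1 , 48) ∷ (56 , 51 , 64) ∷ (56 , 4 , 40) ∷ (56 , 13 , 72) ∷ (56 , 31 , 88) ∷
         (2 , 56 , 32) ∷ (6 , 56 , 48) ∷ (8 , 16 , 22) ∷ (9 , 16 , 16) ∷ (10 , 16 , 28) ∷
         (12 , 16 , 10) ∷ (14 , 56 , 8) ∷ (24 , 3 , 34) ∷ (24 , 1 , 2) ∷ (26 , 4 , 26) ∷
         (33 , 13 , 26) ∷ (34 , 13 , 42) ∷ (35 , 13 , 10) ∷ (36 , 13 , 12) ∷ (36 , 3 , 8) ∷
         (36 , 16 , 14) ∷ (37 , 16 , 2) ∷ (38 , 13 , 2) ∷ (38 , 16 , 10) ∷ (38 , 3 , 6) ∷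
         (40 , 4 , 6) ∷ (40 , 3 , 12) ∷ (42 , 4 , 2) ∷ (48 , 1 , 8) ∷ (48 , 4 , 16) ∷
         (50 , 4 , 6) ∷ (52 , 1 , 30) ∷ []))
       (flow ((4 , 13 , 32) ∷ (13 , 3 , 24) ∷ (16 , 4 , 18) ∷ (20 , 3 , 18) ∷ (16 , 13 , 42) ∷
         (16 , 31 , 58) ∷ (16 , 51 , 72) ∷ (51 , 4 , 48) ∷ (16 , 56 , 280) ∷ (56 , 51 , 64) ∷
         (56 , 4 , 40) ∷ (56 , 13 , 72) ∷ (56 , 31 , 88) ∷ (2 , 56 , 32) ∷ (5 , 16 , 2) ∷
         (6 , 56 , 48) ∷ (8 , 16 , 20) ∷ (9 , 56 , 16) ∷ (10 , 16 , 28) ∷ (12 , 16 , 10) ∷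
         (14 , 56 , 8) ∷ (17 , 56 , 22) ∷ (24 , 3 , 34) ∷ (26 , 4 , 26) ∷ (33 , 56 , 10) ∷
         (33 , 13 , 10) ∷ (33 , 16 , 6) ∷ (34 , 13 , 42) ∷ (35 , 13 , 10) ∷ (36 , 13 , 28) ∷
         (36 , 3 , 6) ∷ (37 , 16 , 2) ∷ (38 , 13 , 2) ∷ (38 , 16 , 8) ∷ (38 , 3 , 8) ∷
         (40 , 4 , 6) ∷ (40 , 3 , 12) ∷ (42 , 4 , 2) ∷ (50 , 4 , 8) ∷ [])))
      (branch 1
       (flow ((4 , 13 , 8) ∷ (16 , 4 , 2) ∷ (20 , 1 , 2) ∷ (16 , 13 , 42) ∷ (16 , 31 , 58) ∷
         (16 , 51 , 72) ∷ (51 , 4 , 48) ∷ (16 , 56 , 328) ∷ (56 , 1 , 48) ∷ (56 , 51 , 64) ∷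
         (56 , 4 , 40) ∷ (56 , 13 , 72) ∷ (56 , 31 , 88) ∷ (2 , 1 , 72) ∷ (6 , 56 , 48) ∷
         (7 , 13 , 16) ∷ (9 , 16 , 16) ∷ (10 , 13 , 8) ∷ (10 , 16 , 24) ∷ (12 , 16 , 10) ∷
         (14 , 16 , 8) ∷ (18 , 56 , 38) ∷ (19 , 4 , 6) ∷ (22 , 1 , 12) ∷ (22 , 56 , 2) ∷
         (24 , 1 , 2) ∷ (26 , 4 , 18) ∷ (26 , 1 , 4) ∷ (33 , 13 , 26) ∷ (34 , 13 , 42) ∷
         (35 , 13 , 10) ∷ (36 , 13 , 12) ∷ (36 , 16 , 22) ∷ (37 , 16 , 2) ∷ (38 , 13 , 2) ∷
         (38 , 16 , 8) ∷ (38 , 1 , 8) ∷ (40 , 4 , 6) ∷ (40 , 1 , 12) ∷ (42 , 4 , 2) ∷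
         (48 , 1 , 8) ∷ (48 , 4 , 8) ∷ (50 , 4 , 8) ∷ (52 , 1 , 30) ∷ (58 , 4 , 6) ∷ []))
       (flow ((4 , 13 , 8) ∷ (16 , 13 , 42) ∷ (16 , 31 , 58) ∷ (16 , 51 , 72) ∷ (51 , 4 , 48) ∷
         (16 , 56 , 280) ∷ (56 , 51 , 64) ∷ (56 , 4 , 40) ∷ (56 , 13 , 72) ∷ (56 , 31 , 88) ∷
         (2 , 56 , 32) ∷ (2 , 13 , 24) ∷ (5 , 16 , 2) ∷ (6 , 56 , 48) ∷ (7 , 16 , 16) ∷
         (9 , 56 , 16) ∷ (10 , 16 , 28) ∷ (12 , 16 , 10) ∷ (14 , 56 , 8) ∷ (17 , 56 , 22) ∷
         (19 , 4 , 2) ∷ (26 , 4 , 26) ∷ (33 , 56 , 10) ∷ (33 , 16 , 16) ∷ (34 , 13 , 42) ∷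
         (35 , 13 , 2) ∷ (35 , 4 , 8) ∷ (36 , 13 , 34) ∷ (37 , 16 , 2) ∷ (38 , 13 , 10) ∷
         (38 , 16 , 8) ∷ (40 , 4 , 6) ∷ (40 , 13 , 4) ∷ (42 , 4 , 2) ∷ (49 , 4 , 8) ∷
         (50 , 4 , 8) ∷ []))))
     (branch 1
      (flow ((1 , 13 , 8) ∷ (16 , 13 , 42) ∷ (16 , 31 , 58) ∷ (16 , 51 , 24) ∷ (16 , 56 , 288) ∷
        (56 , 1 , 48) ∷ (56 , 51 , 64) ∷ (56 , 13 , 72) ∷ (56 , 31 , 88) ∷ (2 , 56 , 32) ∷
        (2 , 13 , 24) ∷ (5 , 51 , 32) ∷ (6 , 56 , 48) ∷ (7 , 51 , 14) ∷ (7 , 16 , 2) ∷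
        (9 , 16 , 16) ∷ (10 , 16 , 32) ∷ (12 , 56 , 14) ∷ (12 , 16 , 10) ∷ (14 , 56 , 8) ∷
        (20 , 56 , 26) ∷ (20 , 1 , 2) ∷ (20 , 51 , 2) ∷ (22 , 1 , 14) ∷ (24 , 1 , 2) ∷
        (26 , 1 , 30) ∷ (33 , 13 , 26) ∷ (34 , 13 , 42) ∷ (35 , 13 , 10) ∷ (36 , 13 , 8) ∷
        (36 , 16 , 26) ∷ (37 , 16 , 2) ∷ (38 , 13 , 2) ∷ (38 , 16 , 16) ∷ (40 , 1 , 14) ∷
        (40 , 13 , 4) ∷ (42 , 1 , 2) ∷ (48 , 1 , 8) ∷ (52 , 1 , 26) ∷ []))
      (branch 2
       (flow ((2 , 13 , 24) ∷ (16 , 13 , 42) ∷ (16 , 31 , 58) ∷ (16 , 51 , 24) ∷ (16 , 56 , 272) ∷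
         (56 , 2 , 32) ∷ (56 , 51 , 64) ∷ (56 , 13 , 72) ∷ (56 , 31 , 88) ∷ (0 , 13 , 8) ∷
         (5 , 51 , 28) ∷ (5 , 16 , 4) ∷ (6 , 56 , 48) ∷ (7 , 16 , 16) ∷ (9 , 56 , 8) ∷
         (9 , 16 , 8) ∷ (10 , 16 , 2) ∷ (12 , 56 , 8) ∷ (12 , 16 , 16) ∷ (14 , 16 , 8) ∷
         (17 , 56 , 22) ∷ (20 , 56 , 26) ∷ (20 , 51 , 4) ∷ (21 , 2 , 2) ∷ (22 , 56 , 8) ∷
         (22 , 51 , 6) ∷ (28 , 2 , 6) ∷ (33 , 56 , 18) ∷ (33 , 16 , 8) ∷ (34 , 13 , 42) ∷
         (35 , 13 , 10) ∷ (36 , 13 , 20) ∷ (36 , 51 , 8) ∷ (36 , 56 , 6) ∷ (37 , 16 , 2) ∷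
         (38 , 16 , 16) ∷ (38 , 51 , 2) ∷ (40 , 13 , 18) ∷ (42 , 13 , 2) ∷ []))
       (flow ((16 , 13 , 42) ∷ (16 , 31 , 58) ∷ (16 , 51 , 24) ∷ (16 , 56 , 240) ∷ (56 , 51 , 64) ∷
         (56 , 13 , 72) ∷ (56 , 31 , 88) ∷ (0 , 13 , 8) ∷ (3 , 13 , 24) ∷ (5 , 51 , 30) ∷
         (5 , 16 , 2) ∷ (6 , 56 , 48) ∷ (7 , 16 , 16) ∷ (9 , 56 , 8) ∷ (9 , 16 , 8) ∷
         (10 , 56 , 30) ∷ (10 , 16 , 2) ∷ (12 , 56 , 14) ∷ (12 , 16 , 10) ∷ (14 , 16 , 8) ∷
         (17 , 56 , 22) ∷ (18 , 56 , 2) ∷ (20 , 56 , 26) ∷ (20 , 51 , 4) ∷ (22 , 56 , 8) ∷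
         (22 , 51 , 6) ∷ (33 , 56 , 18) ∷ (33 , 16 , 8) ∷ (34 , 13 , 42) ∷ (35 , 13 , 10) ∷
         (36 , 13 , 26) ∷ (36 , 51 , 8) ∷ (37 , 16 , 2) ∷ (38 , 13 , 2) ∷ (38 , 16 , 16) ∷
         (40 , 13 , 12) ∷ [])))))
    (branch 1
     (branch 8
      (branch 2
       (flow ((1 , 13 , 32) ∷ (13 , 2 , 24) ∷ (1 , 31 , 58) ∷ (1 , 51 , 24) ∷ (8 , 56 , 48) ∷
         (1 , 56 , 272) ∷ (56 , 2 , 32) ∷ (57 , 51 , 64) ∷ (57 , 13 , 72) ∷ (57 , 31 , 88) ∷
         (4 , 56 , 40) ∷ (4 , 51 , 24) ∷ (5 , 51 , 24) ∷ (6 , 56 , 48) ∷ (14 , 56 , 8) ∷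
         (17 , 13 , 22) ∷ (18 , 8 , 2) ∷ (18 , 1 , 28) ∷ (19 , 8 , 34) ∷ (20 , 13 , 20) ∷
         (20 , 1 , 2) ∷ (20 , 8 , 8) ∷ (22 , 1 , 14) ∷ (24 , 1 , 14) ∷ (33 , 13 , 26) ∷
         (34 , 13 , 42) ∷ (35 , 13 , 10) ∷ (36 , 13 , 12) ∷ (36 , 8 , 22) ∷ (37 , 2 , 2) ∷
         (38 , 13 , 2) ∷ (38 , 1 , 12) ∷ (38 , 8 , 4) ∷ (40 , 1 , 18) ∷ (41 , 2 , 4) ∷
         (42 , 1 , 2) ∷ (44 , 2 , 16) ∷ (48 , 1 , 8) ∷ []))
       (flow ((1 , 13 , 8) ∷ (1 , 31 , 58) ∷ (1 , 51 , 24) ∷ (8 , 56 , 16) ∷ (1 , 56 , 272) ∷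
         (57 , 51 , 64) ∷ (57 , 13 , 72) ∷ (57 , 31 , 88) ∷ (3 , 13 , 24) ∷ (4 , 56 , 40) ∷
         (4 , 51 , 24) ∷ (5 , 51 , 24) ∷ (6 , 56 , 48) ∷ (10 , 56 , 32) ∷ (14 , 56 , 8) ∷
         (17 , 13 , 22) ∷ (18 , 8 , 2) ∷ (18 , 1 , 28) ∷ (19 , 8 , 34) ∷ (20 , 13 , 20) ∷
         (20 , 1 , 2) ∷ (20 , 8 , 8) ∷ (22 , 1 , 14) ∷ (24 , 1 , 14) ∷ (33 , 13 , 26) ∷
         (34 , 13 , 42) ∷ (35 , 13 , 10) ∷ (36 , 13 , 12) ∷ (36 , 8 , 6) ∷ (38 , 13 , 2) ∷
         (38 , 1 , 14) ∷ (38 , 8 , 2) ∷ (40 , 1 , 14) ∷ (42 , 1 , 2) ∷ (48 , 1 , 8) ∷ [])))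
      (branch 4
       (flow ((1 , 13 , 8) ∷ (1 , 31 , 58) ∷ (1 , 51 , 72) ∷ (51 , 4 , 48) ∷ (1 , 56 , 272) ∷
         (57 , 51 , 64) ∷ (4 , 56 , 40) ∷ (57 , 13 , 72) ∷ (57 , 31 , 88) ∷ (0 , 56 , 16) ∷
         (2 , 56 , 32) ∷ (2 , 13 , 24) ∷ (6 , 56 , 48) ∷ (14 , 56 , 8) ∷ (17 , 13 , 22) ∷
         (19 , 4 , 6) ∷ (20 , 13 , 20) ∷ (20 , 1 , 2) ∷ (22 , 1 , 12) ∷ (24 , 1 , 14) ∷
         (33 , 13 , 26) ∷ (34 , 13 , 42) ∷ (35 , 13 , 10) ∷ (36 , 13 , 12) ∷ (38 , 13 , 2) ∷
         (38 , 1 , 14) ∷ (40 , 1 , 14) ∷ (40 , 4 , 4) ∷ (42 , 1 , 2) ∷ (48 , 1 , 24) ∷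
         (49 , 4 , 16) ∷ (50 , 4 , 8) ∷ []))
       (flow ((1 , 13 , 8) ∷ (1 , 31 , 58) ∷ (1 , 51 , 24) ∷ (1 , 56 , 272) ∷ (57 , 51 , 64) ∷
         (57 , 13 , 72) ∷ (57 , 31 , 88) ∷ (0 , 56 , 16) ∷ (2 , 56 , 32) ∷ (2 , 13 , 24) ∷
         (5 , 51 , 32) ∷ (6 , 56 , 48) ∷ (7 , 51 , 16) ∷ (12 , 56 , 24) ∷ (14 , 56 , 8) ∷
         (17 , 13 , 22) ∷ (20 , 56 , 8) ∷ (20 , 13 , 20) ∷ (20 , 1 , 2) ∷ (22 , 1 , 14) ∷
         (24 , 1 , 14) ∷ (33 , 13 , 26) ∷ (34 , 13 , 42) ∷ (35 , 13 , 10) ∷ (36 , 13 , 12) ∷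
         (36 , 56 , 8) ∷ (38 , 13 , 2) ∷ (38 , 1 , 14) ∷ (40 , 1 , 14) ∷ (42 , 1 , 2) ∷
         (48 , 1 , 8) ∷ []))))
     (branch 8
      (branch 3
       (flow ((8 , 13 , 32) ∷ (13 , 3 , 24) ∷ (8 , 31 , 58) ∷ (3 , 51 , 24) ∷ (8 , 56 , 176) ∷
         (8 , 51 , 64) ∷ (56 , 13 , 72) ∷ (56 , 31 , 88) ∷ (2 , 56 , 32) ∷ (4 , 56 , 40) ∷
         (4 , 51 , 24) ∷ (5 , 51 , 24) ∷ (6 , 56 , 48) ∷ (9 , 56 , 16) ∷ (14 , 56 , 8) ∷
         (17 , 56 , 22) ∷ (18 , 8 , 30) ∷ (19 , 8 , 6) ∷ (20 , 13 , 28) ∷ (20 , 8 , 2) ∷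
         (22 , 8 , 14) ∷ (24 , 13 , 14) ∷ (26 , 3 , 28) ∷ (33 , 56 , 10) ∷ (33 , 13 , 16) ∷
         (34 , 13 , 42) ∷ (35 , 13 , 10) ∷ (36 , 13 , 22) ∷ (36 , 8 , 6) ∷ (36 , 3 , 6) ∷
         (37 , 3 , 2) ∷ (38 , 13 , 2) ∷ (38 , 8 , 16) ∷ (40 , 3 , 18) ∷ (42 , 3 , 2) ∷ []))
       (flow ((8 , 13 , 8) ∷ (8 , 31 , 58) ∷ (8 , 56 , 176) ∷ (8 , 51 , 64) ∷ (56 , 13 , 72) ∷
         (56 , 31 , 88) ∷ (0 , 51 , 24) ∷ (2 , 56 , 32) ∷ (2 , 13 , 24) ∷ (4 , 56 , 40) ∷
         (4 , 51 , 24) ∷ (5 , 51 , 24) ∷ (6 , 56 , 48) ∷ (9 , 56 , 16) ∷ (14 , 56 , 8) ∷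
         (17 , 56 , 20) ∷ (17 , 8 , 2) ∷ (18 , 8 , 2) ∷ (19 , 8 , 6) ∷ (20 , 13 , 28) ∷
         (20 , 8 , 2) ∷ (22 , 8 , 14) ∷ (24 , 13 , 14) ∷ (33 , 56 , 12) ∷ (33 , 8 , 14) ∷
         (34 , 13 , 42) ∷ (35 , 13 , 8) ∷ (35 , 8 , 2) ∷ (36 , 13 , 28) ∷ (36 , 8 , 6) ∷
         (37 , 13 , 2) ∷ (38 , 13 , 2) ∷ (38 , 8 , 16) ∷ (40 , 13 , 8) ∷ (42 , 13 , 2) ∷ [])))
      (branch 3
       (flow ((3 , 13 , 24) ∷ (3 , 31 , 58) ∷ (3 , 51 , 24) ∷ (3 , 56 , 152) ∷ (59 , 13 , 88) ∷
         (0 , 56 , 32) ∷ (0 , 13 , 8) ∷ (2 , 56 , 32) ∷ (4 , 56 , 34) ∷ (4 , 51 , 30) ∷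
         (5 , 56 , 32) ∷ (6 , 56 , 48) ∷ (7 , 51 , 16) ∷ (9 , 56 , 16) ∷ (12 , 56 , 6) ∷
         (14 , 56 , 8) ∷ (17 , 56 , 8) ∷ (17 , 13 , 14) ∷ (20 , 13 , 28) ∷ (20 , 3 , 2) ∷
         (22 , 3 , 14) ∷ (24 , 3 , 14) ∷ (33 , 56 , 24) ∷ (33 , 13 , 2) ∷ (34 , 13 , 42) ∷
         (35 , 13 , 10) ∷ (36 , 13 , 34) ∷ (37 , 13 , 2) ∷ (38 , 13 , 2) ∷ (38 , 3 , 14) ∷
         (38 , 51 , 2) ∷ (40 , 3 , 18) ∷ (42 , 3 , 2) ∷ (48 , 13 , 24) ∷ (56 , 13 , 16) ∷ []))
       (flow ((0 , 56 , 26) ∷ (0 , 13 , 8) ∷ (0 , 51 , 24) ∷ (0 , 31 , 30) ∷ (2 , 56 , 32) ∷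
         (2 , 13 , 24) ∷ (2 , 31 , 16) ∷ (4 , 56 , 40) ∷ (4 , 51 , 24) ∷ (5 , 56 , 32) ∷
         (6 , 56 , 48) ∷ (7 , 56 , 16) ∷ (9 , 56 , 16) ∷ (10 , 51 , 32) ∷ (12 , 51 , 24) ∷
         (14 , 56 , 8) ∷ (17 , 56 , 22) ∷ (18 , 13 , 12) ∷ (18 , 56 , 26) ∷ (19 , 56 , 6) ∷
         (20 , 13 , 30) ∷ (22 , 51 , 14) ∷ (24 , 13 , 12) ∷ (24 , 51 , 2) ∷ (33 , 56 , 10) ∷
         (33 , 13 , 16) ∷ (34 , 13 , 42) ∷ (35 , 56 , 10) ∷ (36 , 13 , 22) ∷ (36 , 51 , 10) ∷
         (36 , 31 , 2) ∷ (37 , 56 , 2) ∷ (38 , 13 , 12) ∷ (38 , 31 , 6) ∷ (40 , 51 , 14) ∷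
         (40 , 31 , 4) ∷ (42 , 31 , 2) ∷ (48 , 13 , 24) ∷ (50 , 13 , 8) ∷ (56 , 13 , 10) ∷
         (58 , 13 , 26) ∷ [])))))))

certificate-valid : Valid (map (trace 6) S′) [] [] (balance weights) certificate
certificate-valid =
  toWitness {a? = valid? (map (trace 6) S′) [] [] (balance weights) certificate} tt

-- `U ⟨S′⟩` is all of [6], so a Non-FC witness makes all six elements rare. The weights sum to 88,
-- and `averaging` then gives 0 ≤ -88. Absorption of the generators alone is what the certificate
-- uses, so `S′` serves as `G`.
¬nonFC-⟨S′⟩ : ¬ NonFC ⟨S′⟩
¬nonFC-⟨S′⟩ (_ , F , F-uc , ⟨S′⟩⊆F , rare) = contradiction
  (averaging weights S′ (toWitness {a? = all? (all? (_∈? [1⋯ 6 ])) S′} tt)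
    (λ b closed absorbing → certified b closed {map (trace 6) S′} {[]} {[]} (balance weights)
      certificate certificate-valid (All.map⁺ (All.tabulate absorbing)) [] [])
    F-uc (λ B∈S′ → ⟨S′⟩⊆F (_GeneratorOf_.contains S′-generates B∈S′))
    (λ i i∈ → rare i (All.lookup (toWitness {a? = all? (_∈? U ⟨S′⟩) [1⋯ 6 ]} tt) i∈)))
  λ ()

¬regular-S : ¬ Regular 6 S
¬regular-S regular = ¬nonFC-⟨S′⟩ (regular A (toWitness {a? = A ∈ᶠ? S} tt)
  (toWitnessFalse {a? = A ≋? ∅} tt) 5 (toWitness {a? = 5 ∈? [1⋯ 6 ]} tt) ⟨S′⟩ S′-generates)

corollary4 : let S = ∅ ∷ (4 ∷ 5 ∷ 6 ∷ []) ∷ (1 ∷ 3 ∷ 4 ∷ []) ∷ (1 ∷ 2 ∷ 5 ∷ 6 ∷ []) ∷ (1 ∷ 2 ∷ 3 ∷ 4 ∷ []) ∷ [] in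
    3 ≤ 6
    × U S ≋ [1⋯ 6 ]
    × (∃[ F ] S MinimalGeneratorOf F × NonFC F × ¬ Regular 6 S)
corollary4 = s≤s (s≤s (s≤s z≤n)) , toWitness {a? = U S ≋? [1⋯ 6 ]} tt ,
  ⟨S⟩ , S-minimal , nonFC-⟨S⟩ , ¬regular-S
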